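{- For every $n\ge 1$ there is a bijection $\Theta:S_n(1423)\to S_n(2413)$ such that for every $\pi\in S_n(1423)$: $\operatorname{Des}\Theta(\pi)=\operatorname{Des}\pi$, $\operatorname{RLmax}\Theta(\pi)=\operatorname{RLmax}\pi$, $\operatorname{Stp}\Theta(\pi)=\operatorname{Stp}\pi$, the value $n$ occupies the same position in $\Theta(\pi)$ as in $\pi$, and the value $n-1$ occupies the same position in $\Theta(\pi)$ as in $\pi$. Additionally, if $\pi\in S_n(1423)\cap S_n(2413)$ then $\Theta(\pi)=\pi$.
   Context: Permutations $\pi\in S_n$ are written in one-line notation $\pi_1\ldots\pi_n$. For a sequence of distinct integers, $\mathrm{std}$ of it is the unique permutation order-isomorphic to it. A permutation $\pi$ avoids $\tau\in S_k$ if no subsequence of $\pi$ is order-isomorphic to $\tau$; $S_n(\tau)$ denotes the set of $\tau$-avoiding permutations in $S_n$. $\operatorname{Des}\pi=\{i:\pi_i>\pi_{i+1}\}$ is the descent set. $\operatorname{RLmax}\pi$ is the set of right-to-left maxima of $\pi$, i.e. indices $i$ such that $\pi_i>\pi_j$ for all $j>i$. $\operatorname{Stp}\pi=\{i:\pi_i-1=\pi_{i+1}\}$ is the set of steps of $\pi$. -}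

module Defs where

open import Data.Nat using (ℕ; zero; suc; _∸_)
open import Data.Fin using (Fin; toℕ; _<_) renaming (zero to fz; suc to fs)
open import Data.Vec using (Vec; lookup; []; _∷_)
open import Data.Product using (Σ; ∃; _×_; _,_)
open import Relation.Binary.PropositionalEquality using (_≡_)
open import Relation.Nullary using (¬_)
open import Function.Definitions using (Injective)
open import Function.Bundles using (_⇔_)

-- A permutation in S_n is written in one-line notation as a vector of
-- length n of values in Fin n (value v : Fin n stands for v+1), with
-- all entries distinct.  Positions are Fin n (position i stands for i+1).
Word : ℕ → Set
Word n = Vec (Fin n) n

IsPerm : ∀ {n} → Word n → Set
IsPerm π = Injective _≡_ _≡_ (lookup π)

Contains : ∀ {k n} → Word k → Word n → Set
Contains {k} {n} τ π =
  Σ (Fin k → Fin n) λ ι →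
    (∀ a b → a < b → ι a < ι b) ×
    (∀ a b → (lookup τ a < lookup τ b) ⇔ (lookup π (ι a) < lookup π (ι b)))

Avoids : ∀ {k n} → Word k → Word n → Set
Avoids τ π = ¬ Contains τ π

InAv : ∀ {k n} → Word k → Word n → Set
InAv τ π = IsPerm π × Avoids τ π

p1423 : Word 4
p1423 = fz ∷ fs (fs (fs fz)) ∷ fs fz ∷ fs (fs fz) ∷ []

p2413 : Word 4
p2413 = fs fz ∷ fs (fs (fs fz)) ∷ fz ∷ fs (fs fz) ∷ []

IsDes : ∀ {n} → Word n → Fin n → Set
IsDes {n} π i = ∃ λ (j : Fin n) → toℕ j ≡ suc (toℕ i) × lookup π j < lookup π i

IsRLmax : ∀ {n} → Word n → Fin n → Set
IsRLmax {n} π i = ∀ (j : Fin n) → i < j → lookup π j < lookup π i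

IsStp : ∀ {n} → Word n → Fin n → Set
IsStp {n} π i = ∃ λ (j : Fin n) → toℕ j ≡ suc (toℕ i) × toℕ (lookup π i) ≡ suc (toℕ (lookup π j))

HoldsMax : ∀ {m} → Word (suc m) → Fin (suc m) → Set
HoldsMax {m} π i = toℕ (lookup π i) ≡ m

-- Position i holds the value n-1 (0-based value m-1; impossible if n = 1).
HoldsSecond : ∀ {m} → Word (suc m) → Fin (suc m) → Set
HoldsSecond {m} π i = suc (toℕ (lookup π i)) ≡ m

-- Write a nonempty permutation as α · n · ρ.  If α is nonempty, keep one letter of ρ in each
-- interior gap between the values of α that ρ meets, and put these letters behind α, from large
-- to small; this gives a smaller permutation A with the same pattern avoided.  What remains of π
-- is ρ together with the way α cuts it into levels.  For 2413 the levels of ρ follow each other as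
-- blocks; for 1423 the letters of all levels but the lowest form one decreasing sequence.
-- The same recursion applies to words cut into levels.  Their letters behind the maximum are
-- sorted by level and gap of α.  If there are q thresholds and p occupied interior gaps,
-- the possible pairs form a chain of the same length for both patterns, although
-- the chains differ: for 1423 the gaps of α refine the last level, for 2413 the first one.
-- Hence both classes are encoded by the same trees, and Θ re-reads a tree.  Descents, right-to-left
-- maxima and steps (within a level) can be read off the tree.  For q = 0 the two chains coincide,
-- and in a levelled word valid for both patterns with q > 0 the maximum comes first, so
-- permutations avoiding both patterns have the same tree for both readings.
module Submission where

open import Defs
open import Data.Nat using (ℕ; zero; suc; _+_; _*_; _∸_; _⊓_; _⊔_; _≤_; _<_; z≤n; s≤s; z<s; s<s; s≤s⁻¹; s<s⁻¹)
open import Data.Fin as Fin using (Fin; toℕ; fromℕ<)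
open import Data.Product using (Σ; ∃; _×_; _,_; proj₁; proj₂)
open import Relation.Binary.PropositionalEquality using (_≡_; _≢_; refl; sym; trans; cong; cong₂; subst; subst₂; ≢-sym)
open import Function.Bundles using (_⇔_; mk⇔; Equivalence)
open import Data.Bool using (Bool; true; false)
open import Data.Bool.Properties using (¬-not; not-¬)
open import Data.Nat.Induction using (<-rec)
open import Data.Nat.Properties
open import Data.Fin.Properties using (any?; injective⇒≤; toℕ<n; toℕ-injective; toℕ-fromℕ<; fromℕ<-toℕ; fromℕ<-injective; punchOut-injective)
open import Data.Vec using (lookup; tabulate; []; _∷_)
open import Data.Vec.Properties using (lookup∘tabulate; tabulate∘lookup; tabulate-cong)
open import Data.Sum using (_⊎_; inj₁; inj₂)
open import Data.Empty using (⊥; ⊥-elim)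
open import Data.Unit using (⊤; tt)
open import Function using (_∘_; const)
open import Relation.Nullary using (¬_; Dec; yes; no)
open import Relation.Nullary.Decidable using (map′; ¬?; _×-dec_; _→-dec_)
open import Relation.Binary.Definitions using (tri<; tri≈; tri>)

-- Strictly increasing maps and skipping a level

-- Why the recursion closes: a letter x of α followed by the maximum acts on ρ as a threshold. The
-- letters of ρ above x must decrease (1423), or precede those below x (2413). This is the same
-- condition as that of the thresholds already present, so old and new ones merge into a single list
-- for ρ; α itself has constant level and is coded with no thresholds. The obstacle: the two
-- readings of one tree have different words A, yet the marks must sit in distinct interior gaps of
-- α in both. Hence `Cond` has to be expressible by statistics that the readings share. Consecutive
-- marks share a gap exactly if they form a step; the last mark is in the lowest gap exactly if it
-- is the least letter. Preserving steps thus belongs to the construction itself, and `Low` has to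
-- accompany the statistics of the theorem in the induction. Uniqueness of trees is proved for two
-- readings of possibly different kinds `b` and `b′`: equal kinds make the tree of a word well
-- defined, different kinds give the fixed points.

reflect : ∀ {a b x y} → (a ≡ b → x ≡ y) → (b < a → y < x) → x < y → a < b
reflect {a} {b} e l x<y with <-cmp a b
... | tri< a<b _ _ = a<b
... | tri≈ _ a≡b _ = ⊥-elim (<-irrefl (e a≡b) x<y)
... | tri> _ _ b<a = ⊥-elim (<-asym x<y (l b<a))

Increasing : (ℕ → ℕ) → Set
Increasing f = ∀ {c d} → c < d → f c < f d

module _ {f : ℕ → ℕ} (f↑ : Increasing f) where

  incr-< : ∀ {c d} → f c < f d → c < d
  incr-< = reflect (cong f) f↑

  incr-≤ : ∀ {c d} → f c ≤ f d → c ≤ d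
  incr-≤ p = ≮⇒≥ (λ d<c → <-irrefl refl (<-≤-trans (f↑ d<c) p))

  incr-mono-≤ : ∀ {c d} → c ≤ d → f c ≤ f d
  incr-mono-≤ p = ≮⇒≥ (λ l → <-irrefl refl (<-≤-trans (incr-< l) p))

  incr-inj : ∀ {c d} → f c ≡ f d → c ≡ d
  incr-inj e = ≤-antisym (incr-≤ (≤-reflexive e)) (incr-≤ (≤-reflexive (sym e)))

-- skip false s enumerates the naturals other than s.
skip : Bool → ℕ → ℕ → ℕ
skip true  s       c       = c
skip false zero    c       = suc c
skip false (suc s) zero    = zero
skip false (suc s) (suc c) = suc (skip false s c)

skip-incr : ∀ f s → Increasing (skip f s)
skip-incr true  s       p           = p
skip-incr false zero    p           = s<s p
skip-incr false (suc s) {zero} {suc d} p   = z<s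
skip-incr false (suc s) {suc c} {suc d} p = s<s (skip-incr false s (s<s⁻¹ p))

skip-avoids : ∀ s c → skip false s c ≢ s
skip-avoids (suc s) (suc c) e = skip-avoids s c (suc-injective e)

skip-onto : ∀ f s x → (f ≡ false → x ≢ s) → ∃ λ c → skip f s c ≡ x
skip-onto true  s       x       ne = x , refl
skip-onto false zero    zero    ne = ⊥-elim (ne refl refl)
skip-onto false zero    (suc x) ne = x , refl
skip-onto false (suc s) zero    ne = zero , refl
skip-onto false (suc s) (suc x) ne with skip-onto false s x (λ _ e → ne refl (cong suc e))
... | c , e = suc c , cong suc e

-- For `0 < s` the outer skip fixes 0, so the two vacancies 0 and `s` are cut out independently of
-- each other.
unskip : Bool → Bool → ℕ → ℕ → ℕ
unskip f₁ f₂ s c = skip f₂ s (skip f₁ 0 c)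

skip-zero : ∀ f s → (f ≡ false → 0 < s) → skip f s 0 ≡ 0
skip-zero true  s       _ = refl
skip-zero false zero    p with () ← p refl
skip-zero false (suc s) _ = refl

module _ (f₁ f₂ : Bool) (s : ℕ) where

  unskip-incr : Increasing (unskip f₁ f₂ s)
  unskip-incr p = skip-incr f₂ s (skip-incr f₁ 0 p)

  unskip-avoids-0 : f₁ ≡ false → (f₂ ≡ false → 0 < s) → ∀ c → unskip f₁ f₂ s c ≢ 0
  unskip-avoids-0 refl pos c e with () ← incr-inj (skip-incr f₂ s) (trans e (sym (skip-zero f₂ s pos)))

  unskip-avoids-s : f₂ ≡ false → ∀ c → unskip f₁ f₂ s c ≢ s
  unskip-avoids-s refl c = skip-avoids s _

  unskip-onto : ∀ x → (f₂ ≡ false → 0 < s) → (f₁ ≡ false → x ≢ 0) → (f₂ ≡ false → x ≢ s) →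
                ∃ λ c → unskip f₁ f₂ s c ≡ x
  unskip-onto x pos ne₁ ne₂ with skip-onto f₂ s x ne₂
  ... | y , ey with skip-onto f₁ 0 y (λ e y≡0 → ne₁ e (trans (sym ey) (trans (cong (skip f₂ s) y≡0) (skip-zero f₂ s pos))))
  ... | c , ec = c , trans (cong (skip f₂ s) ec) ey

unskip-zero : ∀ {f₁} f₂ s → f₁ ≡ true → (f₂ ≡ false → 0 < s) → unskip f₁ f₂ s 0 ≡ 0
unskip-zero f₂ s refl pos = skip-zero f₂ s pos

-- Positions of a word split at its maximum

data Pos (a m : ℕ) : ℕ → Set where
  left  : ∀ {i} → i < a → Pos a m i
  peak  : Pos a m a
  right : ∀ {j} → j < m → Pos a m (a + suc j)

pos : ∀ a m {i} → i < a + suc m → Pos a m i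
pos zero    m {zero}  _ = peak
pos zero    m {suc i} p = right (s<s⁻¹ p)
pos (suc a) m {zero}  _ = left z<s
pos (suc a) m {suc i} p with pos a m (s<s⁻¹ p)
... | left q  = left (s<s q)
... | peak    = peak
... | right q = right q

data Adj (a m : ℕ) : ℕ → ℕ → Set where
  left  : ∀ {i} → suc i < a → Adj a m i (suc i)
  rise  : ∀ {i} → suc i ≡ a → Adj a m i a
  fall  : 0 < m → Adj a m a (a + 1)
  right : ∀ {j} → suc j < m → Adj a m (a + suc j) (a + suc (suc j))

adj-suc : ∀ {a m i i′} → Adj a m i i′ → Adj (suc a) m (suc i) (suc i′)
adj-suc (left q)  = left (s<s q)
adj-suc (rise q)  = rise (cong suc q)
adj-suc (fall q)  = fall q
adj-suc (right q) = right q

adj : ∀ a m {i i′} → suc i ≡ i′ → i′ < a + suc m → Adj a m i i′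
adj zero    m {zero}  refl p = fall (s<s⁻¹ p)
adj zero    m {suc i} refl p = right (s<s⁻¹ p)
adj (suc zero)    m {zero} refl p = rise refl
adj (suc (suc a)) m {zero} refl p = left (s<s z<s)
adj (suc a) m {suc i} refl p = adj-suc (adj a m refl (s<s⁻¹ p))

data Pos₂ (a p : ℕ) : ℕ → Set where
  left  : ∀ {i} → i < a → Pos₂ a p i
  right : ∀ {k} → k < p → Pos₂ a p (a + k)

pos₂ : ∀ a p {i} → i < a + p → Pos₂ a p i
pos₂ zero    p l = right l
pos₂ (suc a) p {zero}  l = left z<s
pos₂ (suc a) p {suc i} l with pos₂ a p (s<s⁻¹ l)
... | left q  = left (s<s q)
... | right q = right q

module _ {a : ℕ} where

  left<end : ∀ {m i} → i < a → i < a + m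
  left<end p = <-≤-trans p (m≤m+n a _)

  peak<end : ∀ {m} → a < a + suc m
  peak<end = m<m+n a z<s

  right<end : ∀ {m j} → j < m → a + suc j < a + suc m
  right<end p = +-monoʳ-< a (s<s p)

  right≮left : ∀ {i j} {C : Set} → i < a → a + j < i → C
  right≮left p q = ⊥-elim (<-irrefl refl (<-trans (≤-<-trans (m≤m+n a _) q) p))

  right<right : ∀ {j k} → a + suc j < a + suc k → j < k
  right<right p = s<s⁻¹ (+-cancelˡ-< a _ _ p)

data Gap (p : ℕ) : ℕ → Set where
  top : Gap p 0
  mid : ∀ {k} → k < p → Gap p (suc k)
  bot : Gap p (suc p)

gap : ∀ {p x} → x ≤ suc p → Gap p x
gap {p} {zero}  _ = top
gap {p} {suc x} l with <-cmp x p
... | tri< x<p _ _ = mid x<p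
... | tri≈ _ refl _ = bot
... | tri> _ _ p<x = ⊥-elim (<-irrefl refl (<-≤-trans p<x (s≤s⁻¹ l)))

-- Levelled words

-- A word is a total function together with a length; only the values at positions below the length
-- are meaningful.
Seq : Set
Seq = ℕ → ℕ

-- true stands for 1423, false for 2413; the arguments are the values in order of position.
Pat : Bool → ℕ → ℕ → ℕ → ℕ → Set
Pat true  x y z w = x < z × z < w × w < y
Pat false x y z w = z < x × x < w × w < y

Av : Bool → ℕ → Seq → Set
Av b n X = ∀ {i j k l} → i < j → j < k → k < l → l < n → ¬ Pat b (X i) (X j) (X k) (X l)

Inj : ℕ → Seq → Set
Inj n X = ∀ {i j} → i < n → j < n → X i ≡ X j → i ≡ j

LvCond : Bool → ℕ → ℕ → Seq → Seq → Set
LvCond true  q n X l = ∀ {i j} → i < j → j < n → l i < q → l j < q → X j < X i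
LvCond false q n X l = ∀ {i j} → i < j → j < n → l i ≤ l j

-- A word ρ whose letters are cut by q thresholds into the levels 0 (topmost), …, q, of which only
-- the last one may be empty.  It is valid iff d₁ > … > d_q followed by a new maximum and ρ avoids
-- the pattern, where the d's are the thresholds.
record Valid (b : Bool) (q n : ℕ) (X l : Seq) : Set where
  field
    inj  : Inj n X
    av   : Av b n X
    bnd  : ∀ {i} → i < n → l i ≤ q
    occ  : ∀ {c} → c < q → ∃ λ j → j < n × l j ≡ c
    anti : ∀ {i j} → i < n → j < n → X i < X j → l j ≤ l i
    lv   : LvCond b q n X l

RL : ℕ → Seq → ℕ → Set
RL n X i = ∀ {k} → i < k → k < n → X k < X i

-- No letter of the word lies between the two values, and, the levels being equal, no threshold does
-- either.
record Stp (n : ℕ) (X l : Seq) (i i′ : ℕ) : Set where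
  constructor stp
  field
    des  : X i′ < X i
    same : l i′ ≡ l i
    none : ∀ {k} → k < n → X i′ < X k → X k < X i → ⊥

-- The last letter is below all other letters and all thresholds. For a word A ending in marks this
-- says that the last mark is in the lowest gap.
record Low (q n : ℕ) (X l : Seq) : Set where
  constructor isLow
  field
    last  : ℕ
    isEnd : n ≡ suc last
    lvl   : l last ≡ q
    least : ∀ {k} → k < last → X last < X k

record Imp (q n : ℕ) (X l Y l′ : Seq) : Set where
  field
    des  : ∀ {i i′} → suc i ≡ i′ → i′ < n → X i′ < X i → Y i′ < Y i
    rl   : ∀ {i} → i < n → RL n X i → RL n Y i
    step : ∀ {i i′} → suc i ≡ i′ → i′ < n → Stp n X l i i′ → Stp n Y l′ i i′
    low  : Low q n X l → Low q n Y l′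

Sim : (q n : ℕ) (X l Y l′ : Seq) → Set
Sim q n X l Y l′ = Imp q n X l Y l′ × Imp q n Y l′ X l

-- A carries a nonempty word α in its first a positions, followed by p letters marking distinct
-- gaps of α other than the highest and the lowest one, from high to low.
record Cond (a p : ℕ) (A : Seq) : Set where
  field
    high : ∃ λ i → i < a × RL (a + p) A i
    sep  : ∀ {k} → suc k < p → ∃ λ i → i < a × A (a + suc k) < A i × A i < A (a + k)
    lowest : ∀ {k} → suc k ≡ p → ∃ λ i → i < a × A i < A (a + k)

-- X = α · max · ρ, where ρ has the order of F and its j-th letter lies in the gap g j of α.
record Node (a m p : ℕ) (X A F g : Seq) : Set where
  field
    cond : Cond a p A
    inα  : ∀ {i j} → i < a → j < a → A i < A j → X i < X j
    maxα : ∀ {i} → i < a → X i < X a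
    maxρ : ∀ {j} → j < m → X (a + suc j) < X a
    inρ  : ∀ {i j} → i < m → j < m → F i < F j → X (a + suc i) < X (a + suc j)
    g≤   : ∀ {j} → j < m → g j ≤ suc p
    occ  : ∀ {k} → k < p → ∃ λ j → j < m × g j ≡ suc k
    above : ∀ {i j} → i < a → j < m → g j ≡ 0 → X i < X (a + suc j)
    up   : ∀ {i j k} → i < a → j < m → k < p → g j ≡ suc k → A i < A (a + k) → X i < X (a + suc j)
    down : ∀ {i j k} → i < a → j < m → k < p → g j ≡ suc k → A (a + k) < A i → X (a + suc j) < X i
    below : ∀ {i j} → i < a → j < m → g j ≡ suc p → X (a + suc j) < X i

-- Levels grow downwards. For 1423 α has the last level, so a letter below some letter of α has it
-- too; for 2413 α has level 0, so a letter of positive level lies below all of α.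
Mode : Bool → (q p g l : ℕ) → Set
Mode true  q p g l = 0 < g → l ≡ q
Mode false q p g l = 0 < l → g ≡ suc p

-- The index of the corner of the chain: level `q` with the top gap for 1423, level 0 with the
-- bottom gap for 2413. Its level is that of α and its gap is an extreme one, so nothing demands a
-- letter of ρ there.
skipped : Bool → (q p : ℕ) → ℕ
skipped true  q p = q
skipped false q p = suc p

-- α precedes the maximum, which has level 0: its levels are extreme since for 1423 the letters
-- of level below q decrease, and for 2413 the levels increase along the word.
αlevel : Bool → ℕ → ℕ
αlevel true  q = q
αlevel false q = 0

-- The pairs (l , g) of a level and a gap of α that can occur in ρ form a chain, on which g + l
-- runs through 0, …, q + suc p.  Only the indices 0 and skipped b q p may be vacant; f₁ and f₂
-- tell whether they are occupied.
record Levels (b : Bool) (q a m p N : ℕ) (f₁ f₂ : Bool) (l g lF : Seq) : Set where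
  field
    onα  : ∀ {i} → i < a → l i ≡ αlevel b q
    onMax : l a ≡ 0
    sum  : ∀ {j} → j < m → g j + l (a + suc j) ≡ unskip f₁ f₂ (skipped b q p) (lF j)
    l≤   : ∀ {j} → j < m → l (a + suc j) ≤ q
    mode : ∀ {j} → j < m → Mode b q p (g j) (l (a + suc j))
    N≡   : unskip f₁ f₂ (skipped b q p) N ≡ q + suc p
    q>0  : f₂ ≡ false → 0 < q

-- `first` is the case of an empty α: there are no gaps, and removing the maximum can vacate only
-- level 0, which `f` records. `N` is the number of thresholds on ρ.
data Tree : Set where
  nil   : Tree
  first : (f : Bool) (m N : ℕ) → Tree → Tree
  node  : (a m p N : ℕ) (f₁ f₂ : Bool) → Tree → Tree → Tree

-- In each constructor the pattern itself enters only through `Levels`; the rest is common to both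
-- readings.
data Enc (b : Bool) : Tree → (q n : ℕ) (X l : Seq) → Set where
  nil   : ∀ {X l} → Enc b nil 0 0 X l
  first : ∀ {f m N t q n X l lF} → n ≡ suc m → q ≡ skip f 0 N → l 0 ≡ 0 →
          (∀ {j} → j < m → X (suc j) < X 0) →
          (∀ {j} → j < m → l (suc j) ≡ skip f 0 (lF j)) →
          Enc b t N m (X ∘ suc) lF → Enc b (first f m N t) q n X l
  node  : ∀ {a m p N f₁ f₂ tA tF q n X l A F lF g} → n ≡ a + suc m →
          Node a m p X A F g → Levels b q a m p N f₁ f₂ l g lF →
          Enc b tA 0 (a + p) A (const 0) → Enc b tF N m F lF →
          Enc b (node a m p N f₁ f₂ tA tF) q n X l

-- Comparison along the chain of levels and gaps

<⇒≢′ : ∀ {x y} {C : Set} → x < y → x ≡ y → C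
<⇒≢′ x<y x≡y = ⊥-elim (<-irrefl x≡y x<y)

asym : ∀ {x y} {C : Set} → x < y → y < x → C
asym p q = ⊥-elim (<-asym p q)

-- If one coordinate went strictly down, the hypotheses would keep the other from going up, and the
-- sum would drop.
lift-mono : ∀ {g l g′ l′} → (g′ < g → l′ ≤ l) → (l′ < l → g′ ≤ g) → g + l ≤ g′ + l′ → g ≤ g′ × l ≤ l′
lift-mono u v h =
  ≮⇒≥ (λ lt → <-irrefl refl (<-≤-trans (+-mono-<-≤ lt (u lt)) h)) ,
  ≮⇒≥ (λ lt → <-irrefl refl (<-≤-trans (+-mono-≤-< (v lt) lt) h))

0<-or : ∀ x {C : Set} → (x ≡ 0 → C) → (0 < x → C) → C
0<-or zero    z p = z refl
0<-or (suc x) z p = p z<s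

-- `Mode` confines the pairs to an L-shaped path, along which both coordinates are monotone in the
-- sum. A pair is thus determined by `g + l`.
mode-mono : ∀ b {q p g l g′ l′} → g ≤ suc p → l ≤ q → g′ ≤ suc p → l′ ≤ q →
            Mode b q p g l → Mode b q p g′ l′ → g + l ≤ g′ + l′ → g ≤ g′ × l ≤ l′
mode-mono true {g = g} {g′ = g′} g≤ l≤ g′≤ l′≤ md md′ = lift-mono
  (λ lt → ≤-trans l′≤ (≤-reflexive (sym (md (≤-<-trans z≤n lt)))))
  (λ lt → 0<-or g′ (λ e → ≤-trans (≤-reflexive e) z≤n) (λ o → <⇒≢′ (<-≤-trans lt l≤) (md′ o)))
mode-mono false {l = l} {l′ = l′} g≤ l≤ g′≤ l′≤ md md′ = lift-mono
  (λ lt → 0<-or l′ (λ e → ≤-trans (≤-reflexive e) z≤n) (λ o → <⇒≢′ (<-≤-trans lt g≤) (md′ o)))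
  (λ lt → ≤-trans g′≤ (≤-reflexive (sym (md (≤-<-trans z≤n lt)))))

s>0 : ∀ b {q p f₂} → (f₂ ≡ false → 0 < q) → f₂ ≡ false → 0 < skipped b q p
s>0 true  h e = h e
s>0 false h e = z<s

αlevel≤ : ∀ b {q} → αlevel b q ≤ q
αlevel≤ true  = ≤-refl
αlevel≤ false = z≤n

Pat-map : ∀ b {x y z w x′ y′ z′ w′} →
          (x < z → x′ < z′) → (z < x → z′ < x′) → (x < w → x′ < w′) → (z < w → z′ < w′) → (w < y → w′ < y′) →
          Pat b x y z w → Pat b x′ y′ z′ w′
Pat-map true  xz zx xw zw wy (s , t , u) = xz s , zw t , wy u
Pat-map false xz zx xw zw wy (s , t , u) = zx s , xw t , wy u

w<y : ∀ b {x y z w} → Pat b x y z w → w < y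
w<y true  (_ , _ , u) = u
w<y false (_ , _ , u) = u

x<w : ∀ b {x y z w} → Pat b x y z w → x < w
x<w true  (s , t , _) = <-trans s t
x<w false (_ , t , _) = t

z<x⊎z<w : ∀ b {x y z w} → Pat b x y z w → z < x ⊎ z < w
z<x⊎z<w true  (_ , t , _) = inj₂ t
z<x⊎z<w false (s , _ , _) = inj₁ s

-- The index g + l of the letters of ρ in the level c > 0.
levelIndex : Bool → (p c : ℕ) → ℕ
levelIndex true  p c = c
levelIndex false p c = suc p + c

levelIndex< : ∀ b p {q c} → c < q → levelIndex b p c < q + suc p
levelIndex< true  p {q} c<q = <-≤-trans c<q (m≤m+n q _)
levelIndex< false p {q} {c} c<q = subst (suc p + c <_) (+-comm (suc p) q) (+-monoʳ-< (suc p) c<q)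

levelIndex≢0 : ∀ b p {c} → levelIndex b p (suc c) ≢ 0
levelIndex≢0 true  p ()
levelIndex≢0 false p ()

levelIndex≢skipped : ∀ b p {q c} → suc c < q → levelIndex b p (suc c) ≢ skipped b q p
levelIndex≢skipped true  p c<q e = <-irrefl e c<q
levelIndex≢skipped false p {c = c} c<q e = <-irrefl (sym e) (m<m+n (suc p) z<s)

levelIndex-level : ∀ b {q p g l c} → Mode b q p g l → g ≤ suc p → suc c < q →
                   g + l ≡ levelIndex b p (suc c) → l ≡ suc c
levelIndex-level true {q} {g = g} {l} md g≤ c<q e = 0<-or g (λ { refl → e })
  (λ o → ⊥-elim (<-irrefl refl (<-≤-trans c<q (≤-trans (≤-reflexive (sym (md o))) (≤-trans (m≤n+m l g) (≤-reflexive e))))))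
levelIndex-level false {p = p} {g} {l} md g≤ c<q e = 0<-or l
  (λ { refl → ⊥-elim (<-irrefl refl (<-≤-trans (m<m+n (suc p) z<s)
                (≤-trans (≤-reflexive (trans (sym e) (+-identityʳ g))) g≤))) })
  (λ o → +-cancelˡ-≡ (suc p) _ _ (subst (λ x → x + l ≡ _) (md o) e))

decreasing : ∀ {p} (X : Seq) → (∀ {k} → suc k < p → X (suc k) < X k) →
             ∀ {k k′} → k < k′ → k′ < p → X k′ < X k
decreasing X d {k} {suc k′} k<k′ k′<p with m≤n⇒m<n∨m≡n (s≤s⁻¹ k<k′)
... | inj₁ lt   = <-trans (d k′<p) (decreasing X d lt (<-trans (n<1+n k′) k′<p))
... | inj₂ refl = d k′<p

-- From a decomposition at the maximum to validity and statistics

module CondFacts {a p A} (c : Cond a p A) where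
  open Cond c public

  a>0 : 0 < a
  a>0 = ≤-<-trans z≤n (proj₁ (proj₂ high))

  highest : ∀ {k} → k < p → ∃ λ i → i < a × A (a + k) < A i
  highest k<p = proj₁ high , proj₁ (proj₂ high) ,
    proj₂ (proj₂ high) (≤-trans (proj₁ (proj₂ high)) (m≤m+n a _)) (+-monoʳ-< a k<p)

  dec : ∀ {k k′} → k < k′ → k′ < p → A (a + k′) < A (a + k)
  dec = decreasing (A ∘ (a +_)) λ h → let (_ , _ , u , v) = sep h in <-trans u v

  sepAll : ∀ {k k′} → k < k′ → k′ < p → ∃ λ i → i < a × A (a + k′) < A i × A i < A (a + k)
  sepAll {k} {suc k′} k<k′ k′<p with sep k′<p | m≤n⇒m<n∨m≡n (s≤s⁻¹ k<k′)
  ... | i , l , u , v | inj₁ lt = i , l , u , <-trans v (dec lt (<-trans (n<1+n k′) k′<p))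
  ... | i , l , u , v | inj₂ refl = i , l , u , v

  lowestAll : ∀ {k} → k < p → ∃ λ i → i < a × A i < A (a + k)
  lowestAll {k} (s≤s {n = p′} k≤p′) with lowest {p′} refl | m≤n⇒m<n∨m≡n k≤p′
  ... | i , l , u | inj₁ lt = i , l , <-trans u (dec lt (n<1+n p′))
  ... | i , l , u | inj₂ refl = i , l , u

module NodeFacts {b q a m p N f₁ f₂ X l A F lF g}
  (nd : Node a m p X A F g) (lvs : Levels b q a m p N f₁ f₂ l g lF)
  (vA : Valid b 0 (a + p) A (const 0)) (vF : Valid b N m F lF) where

  open Node nd
  open CondFacts cond hiding (high; sep; lowest) public
  open Levels lvs
  private
    module VA = Valid vA
    module VF = Valid vF
    n = a + suc m

  U : ℕ → ℕ
  U = unskip f₁ f₂ (skipped b q p)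

  U↑ : Increasing U
  U↑ = unskip-incr f₁ f₂ _

  ρ : ℕ → ℕ
  ρ j = a + suc j

  inα⁻ : ∀ {i j} → i < a → j < a → X i < X j → A i < A j
  inα⁻ p q = reflect (λ e → cong X (VA.inj (left<end p) (left<end q) e)) (inα q p)

  inρ⁻ : ∀ {i j} → i < m → j < m → X (ρ i) < X (ρ j) → F i < F j
  inρ⁻ p q = reflect (λ e → cong (X ∘ ρ) (VF.inj p q e)) (inρ q p)

  α≢mark : ∀ {i k} → i < a → k < p → A i ≢ A (a + k)
  α≢mark i<a k<p e = <⇒≢′ (<-≤-trans i<a (m≤m+n a _)) (VA.inj (left<end i<a) (+-monoʳ-< a k<p) e)

  up⁻ : ∀ {i j k} → i < a → j < m → k < p → g j ≡ suc k → X i < X (ρ j) → A i < A (a + k)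
  up⁻ i j k e = reflect (λ e′ → ⊥-elim (α≢mark i k e′)) (down i j k e)

  down⁻ : ∀ {i j k} → i < a → j < m → k < p → g j ≡ suc k → X (ρ j) < X i → A (a + k) < A i
  down⁻ i j k e = reflect (λ e′ → ⊥-elim (α≢mark i k (sym e′))) (up i j k e)

  -- The level inside ρ is a place on the chain, so it orders the gaps and the outer levels at once.
  sum≤ : ∀ {i j} → i < m → j < m → lF i ≤ lF j → g i ≤ g j × l (ρ i) ≤ l (ρ j)
  sum≤ i j h = mode-mono b (g≤ i) (l≤ i) (g≤ j) (l≤ j) (mode i) (mode j)
    (≤-trans (≤-reflexive (sum i)) (≤-trans (incr-mono-≤ U↑ h) (≤-reflexive (sym (sum j)))))

  sum≤⁻ : ∀ {i j} → i < m → j < m → g i ≤ g j → l (ρ i) ≤ l (ρ j) → lF i ≤ lF j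
  sum≤⁻ i j u v = incr-≤ U↑ (≤-trans (≤-reflexive (sym (sum i))) (≤-trans (+-mono-≤ u v) (≤-reflexive (sum j))))

  antiρ : ∀ {i j} → i < m → j < m → X (ρ i) < X (ρ j) → g j ≤ g i × l (ρ j) ≤ l (ρ i)
  antiρ i j lt = sum≤ j i (VF.anti i j (inρ⁻ i j lt))

  gap>0 : ∀ {i j} → i < a → j < m → X (ρ j) < X i → 0 < g j
  gap>0 {j = j} i j<m lt = 0<-or (g j) (λ e → asym lt (above i j<m e)) (λ o → o)

  gap≤p : ∀ {i j} → i < a → j < m → X i < X (ρ j) → g j ≤ p
  gap≤p i j lt = s≤s⁻¹ (≤∧≢⇒< (g≤ j) (λ e → asym lt (below i j e)))

  sameGap : ∀ {i j j′} → i < a → j < m → j′ < m → g j ≡ g j′ → X (ρ j) < X i → X i < X (ρ j′) → ⊥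
  sameGap {i} {j} {j′} i<a j<m j′<m e u v = go (gap (g≤ j<m)) refl
    where
    go : ∀ {x} → Gap p x → g j ≡ x → ⊥
    go top       e′ = asym u (above i<a j<m e′)
    go bot       e′ = asym v (below i<a j′<m (trans (sym e) e′))
    go (mid k<p) e′ = asym (up⁻ i<a j′<m k<p (trans (sym e) e′) v) (down⁻ i<a j<m k<p e′ u)

  -- `Cond` supplies the letter of α: between two marks, above the highest or below the lowest one,
  -- according to the gaps involved.
  separated : ∀ {j j′} → j < m → j′ < m → g j < g j′ → ∃ λ i → i < a × X (ρ j′) < X i × X i < X (ρ j)
  separated {j} {j′} j<m j′<m = go (gap (g≤ j<m)) (gap (g≤ j′<m)) refl refl
    where
    go : ∀ {x y} → Gap p x → Gap p y → g j ≡ x → g j′ ≡ y → x < y →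
         ∃ λ i → i < a × X (ρ j′) < X i × X i < X (ρ j)
    go top bot e e′ _ = 0 , a>0 , below a>0 j′<m e′ , above a>0 j<m e
    go top (mid k) e e′ _ with highest k
    ... | i , i<a , u = i , i<a , down i<a j′<m k e′ u , above i<a j<m e
    go (mid k) (mid k′) e e′ lt with sepAll (s<s⁻¹ lt) k′
    ... | i , i<a , u , v = i , i<a , down i<a j′<m k′ e′ u , up i<a j<m k e v
    go (mid k) bot e e′ _ with lowestAll k
    ... | i , i<a , u = i , i<a , below i<a j′<m e′ , up i<a j<m k e u
    go (mid k) top _ _ ()
    go bot (mid k) _ _ lt = ⊥-elim (<-asym k (s<s⁻¹ lt))
    go bot bot _ _ lt = ⊥-elim (<-irrefl refl lt)
    go bot top _ _ ()

  above-some : ∀ {j} → j < m → g j ≤ p → ∃ λ i → i < a × X i < X (ρ j)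
  above-some {j} j<m gj≤p = go (gap (g≤ j<m)) refl
    where
    go : ∀ {x} → Gap p x → g j ≡ x → ∃ λ i → i < a × X i < X (ρ j)
    go top     e = 0 , a>0 , above a>0 j<m e
    go bot     e = ⊥-elim (<-irrefl refl (≤-trans (≤-reflexive (sym e)) gj≤p))
    go (mid k) e with lowestAll k
    ... | i , i<a , u = i , i<a , up i<a j<m k e u

  below-some : ∀ {j} → j < m → 0 < g j → ∃ λ i → i < a × X (ρ j) < X i
  below-some {j} j<m 0<gj = go (gap (g≤ j<m)) refl
    where
    go : ∀ {x} → Gap p x → g j ≡ x → ∃ λ i → i < a × X (ρ j) < X i
    go top     e = <⇒≢′ 0<gj (sym e)
    go bot     e = 0 , a>0 , below a>0 j<m e
    go (mid k) e with highest k
    ... | i , i<a , u = i , i<a , down i<a j<m k e u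

  -- The end of the chain, with index `q + suc p`, belongs to the bottom gap, which `g j ≤ p`
  -- excludes.
  lF<N : ∀ {j} → j < m → g j ≤ p → lF j < N
  lF<N j gj = incr-< U↑ (subst₂ _<_ (sum j) (trans (+-comm (suc p) q) (sym N≡)) (+-mono-<-≤ (s≤s gj) (l≤ j)))

  injX : Inj n X
  injX {i} {j} i<n j<n e = go (pos a m i<n) (pos a m j<n) e
    where
    α≢ρ : ∀ {i j} {C : Set} → i < a → j < m → X i ≡ X (ρ j) → C
    α≢ρ {i} {j} {C} i<a j<m e = go (gap (g≤ j<m)) refl
      where
      go : ∀ {x} → Gap p x → g j ≡ x → C
      go top e′ = <⇒≢′ (above i<a j<m e′) e
      go bot e′ = <⇒≢′ (below i<a j<m e′) (sym e)
      go (mid {k} k<p) e′ with <-cmp (A i) (A (a + k))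
      ... | tri< t _ _ = <⇒≢′ (up i<a j<m k<p e′ t) e
      ... | tri≈ _ t _ = ⊥-elim (α≢mark i<a k<p t)
      ... | tri> _ _ t = <⇒≢′ (down i<a j<m k<p e′ t) (sym e)
    go : ∀ {i j} → Pos a m i → Pos a m j → X i ≡ X j → i ≡ j
    go {i} {j} (left u) (left v) e with <-cmp (A i) (A j)
    ... | tri< t _ _ = <⇒≢′ (inα u v t) e
    ... | tri≈ _ t _ = VA.inj (left<end u) (left<end v) t
    ... | tri> _ _ t = <⇒≢′ (inα v u t) (sym e)
    go (left u)  peak      e = <⇒≢′ (maxα u) e
    go (left u)  (right v) e = α≢ρ u v e
    go peak      (left v)  e = <⇒≢′ (maxα v) (sym e)
    go peak      peak      e = refl
    go peak      (right v) e = <⇒≢′ (maxρ v) (sym e)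
    go (right u) (left v)  e = α≢ρ v u (sym e)
    go (right u) peak      e = <⇒≢′ (maxρ u) e
    go (right {i} u) (right {j} v) e with <-cmp (F i) (F j)
    ... | tri< t _ _ = <⇒≢′ (inρ u v t) e
    ... | tri≈ _ t _ = cong ρ (VF.inj u v t)
    ... | tri> _ _ t = <⇒≢′ (inρ v u t) (sym e)

  ≮peak : ∀ {i} → i < n → X a < X i → ⊥
  ≮peak i<n lt with pos a m i<n
  ... | left u  = asym lt (maxα u)
  ... | peak    = <-irrefl refl lt
  ... | right u = asym lt (maxρ u)

  bound : ∀ {i} → i < n → l i ≤ q
  bound i<n with pos a m i<n
  ... | left u  = ≤-trans (≤-reflexive (onα u)) (αlevel≤ b)
  ... | peak    = ≤-trans (≤-reflexive onMax) z≤n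
  ... | right u = l≤ u

  antiX : ∀ {i j} → i < n → j < n → X i < X j → l j ≤ l i
  antiX i<n j<n lt = go (pos a m i<n) (pos a m j<n) lt
    where
    αα : ∀ {i j} → i < a → j < a → l j ≤ l i
    αα u v = ≤-reflexive (trans (onα v) (sym (onα u)))
    ρα : ∀ b → (∀ {i} → i < a → l i ≡ αlevel b q) → (∀ {j} → j < m → Mode b q p (g j) (l (ρ j))) →
         ∀ {i j} → i < m → j < a → X (ρ i) < X j → l j ≤ l (ρ i)
    ρα true  onα mode i j lt = ≤-reflexive (trans (onα j) (sym (mode i (gap>0 j i lt))))
    ρα false onα mode i j lt = ≤-trans (≤-reflexive (onα j)) z≤n
    αρ : ∀ b → (∀ {i} → i < a → l i ≡ αlevel b q) → (∀ {j} → j < m → Mode b q p (g j) (l (ρ j))) →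
         ∀ {i j} → i < a → j < m → X i < X (ρ j) → l (ρ j) ≤ l i
    αρ true  onα mode i j lt = ≤-trans (l≤ j) (≤-reflexive (sym (onα i)))
    αρ false onα mode {j = j} i j<m lt = 0<-or (l (ρ j)) (λ e → ≤-trans (≤-reflexive e) z≤n)
      (λ o → ⊥-elim (<-irrefl refl (≤-trans (≤-reflexive (sym (mode j<m o))) (gap≤p i j<m lt))))
    go : ∀ {i j} → Pos a m i → Pos a m j → X i < X j → l j ≤ l i
    go _         peak      lt = ≤-trans (≤-reflexive onMax) z≤n
    go peak      (left v)  lt = asym lt (maxα v)
    go peak      (right v) lt = asym lt (maxρ v)
    go (left u)  (left v)  lt = αα u v
    go (left u)  (right v) lt = αρ b onα mode u v lt
    go (right u) (left v)  lt = ρα b onα mode u v lt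
    go (right u) (right v) lt = proj₂ (antiρ u v lt)

  U-occ : ∀ {x} → x < q + suc p → (f₁ ≡ false → x ≢ 0) → (f₂ ≡ false → x ≢ skipped b q p) →
          ∃ λ j → j < m × g j + l (ρ j) ≡ x
  U-occ {x} x< ne₁ ne₂ with unskip-onto f₁ f₂ (skipped b q p) x (s>0 b q>0) ne₁ ne₂
  ... | c , Uc≡x with VF.occ (incr-< U↑ (subst₂ _<_ (sym Uc≡x) (sym N≡) x<))
  ... | j , j<m , e = j , j<m , trans (sum j<m) (trans (cong U e) Uc≡x)

  occupied : ∀ {c} → c < q → ∃ λ j → j < n × l j ≡ c
  occupied {zero}  _ = a , peak<end , onMax
  -- A level strictly between 0 and `q` has an index different from both possible vacancies, so some
  -- letter of ρ carries it.
  occupied {suc c} c<q with U-occ (levelIndex< b p c<q) (λ _ → levelIndex≢0 b p) (λ _ → levelIndex≢skipped b p c<q)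
  ... | j , j<m , e = ρ j , right<end j<m , levelIndex-level b (mode j<m) (g≤ j<m) c<q e

  lvX : ∀ b → (∀ {i} → i < a → l i ≡ αlevel b q) → (∀ {j} → j < m → Mode b q p (g j) (l (ρ j))) →
        LvCond b N m F lF → LvCond b q n X l
  lvX true onα mode lvF i<j j<n li lj = go (pos a m (<-trans i<j j<n)) (pos a m j<n) i<j li lj
    where
    g≤p : ∀ {j} → j < m → l (ρ j) < q → g j ≤ p
    g≤p {j} u h = 0<-or (g j) (λ e → ≤-trans (≤-reflexive e) z≤n) (λ o → <⇒≢′ h (mode u o))
    go : ∀ {i j} → Pos a m i → Pos a m j → i < j → l i < q → l j < q → X j < X i
    go (left u)  _         _   li lj = <⇒≢′ li (onα u)
    go peak      (left v)  i<j li lj = asym v i<j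
    go peak      peak      i<j li lj = ⊥-elim (<-irrefl refl i<j)
    go peak      (right v) i<j li lj = maxρ v
    go (right u) (left v)  i<j li lj = right≮left v i<j
    go (right {j} u) peak  i<j li lj = ⊥-elim (<-irrefl refl (≤-<-trans (m≤m+n a _) i<j))
    go (right u) (right v) i<j li lj = inρ v u (lvF (right<right {a} i<j) v (lF<N u (g≤p u li)) (lF<N v (g≤p v lj)))
  lvX false onα mode lvF i<j j<n = go (pos a m (<-trans i<j j<n)) (pos a m j<n) i<j
    where
    go : ∀ {i j} → Pos a m i → Pos a m j → i < j → l i ≤ l j
    go (left u)  _         i<j = ≤-trans (≤-reflexive (onα u)) z≤n
    go peak      _         i<j = ≤-trans (≤-reflexive onMax) z≤n
    go (right u) (left v)  i<j = right≮left v i<j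
    go (right {j} u) peak  i<j = ⊥-elim (<-irrefl refl (≤-<-trans (m≤m+n a _) i<j))
    go (right u) (right v) i<j = proj₂ (sum≤ u v (lvF (right<right {a} i<j) v))

  -- The last letter of an occurrence whose other letters lie in α can be replaced by a mark.
  avX : Av b n X
  avX {i} {j} {k} {l} i<j j<k k<l l<n = go (pos a m (<-trans k<l l<n)) (pos a m l<n) i<j j<k k<l
    where
    -- For 1423, letters of ρ above a letter of α have level below `N` and so decrease. For 2413,
    -- levels increase along ρ while a rise in value forbids this to be strict, so both letters
    -- share a gap, which the letter of α would cut.
    split-left : ∀ b → LvCond b N m F lF → ∀ {i x k l} → i < a → k < m → l < m → k < l →
                 ¬ Pat b (X i) x (X (ρ k)) (X (ρ l))
    split-left true lvF i k l k<l (s , t , _) =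
      asym (inρ⁻ k l t) (lvF k<l l (lF<N k (gap≤p i k s)) (lF<N l (gap≤p i l (<-trans s t))))
    split-left false lvF i k l k<l (s , t , _) =
      sameGap i k l (≤-antisym (proj₁ (sum≤ k l (lvF k<l l))) (proj₁ (antiρ k l (<-trans s t)))) s t
    go : ∀ {i j k l} → Pos a m k → Pos a m l → i < j → j < k → k < l → ¬ Pat b (X i) (X j) (X k) (X l)
    go _ (left v) i<j j<k k<l P =
      VA.av i<j j<k k<l (left<end v) (Pat-map b (inα⁻ i′ k′) (inα⁻ k′ i′) (inα⁻ i′ v) (inα⁻ k′ v) (inα⁻ v j′) P)
      where
      k′ = <-trans k<l v
      j′ = <-trans j<k k′
      i′ = <-trans i<j j′
    go _ peak i<j j<k k<l P = ≮peak (<-trans (<-trans j<k k<l) peak<end) (w<y b P)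
    go {i} {j} {k} (left u) (right {l} v) i<j j<k k<l P = mark (gap (g≤ v)) refl
      where
      j′ = <-trans j<k u
      i′ = <-trans i<j j′
      mark : ∀ {x} → Gap p x → g l ≡ x → ⊥
      mark top     e = asym (w<y b P) (above j′ v e)
      mark bot     e = asym (x<w b P) (below i′ v e)
      mark (mid o) e = VA.av i<j j<k (<-≤-trans u (m≤m+n a _)) (+-monoʳ-< a o)
        (Pat-map b (inα⁻ i′ u) (inα⁻ u i′) (up⁻ i′ v o e) (up⁻ u v o e) (down⁻ j′ v o e) P)
    go peak (right v) i<j j<k k<l P with z<x⊎z<w b P
    ... | inj₁ lt = ≮peak (<-trans (<-trans i<j j<k) peak<end) lt
    ... | inj₂ lt = ≮peak (right<end v) lt
    go {i} {j} (right u) (right v) i<j j<k k<l P with pos a m (<-trans i<j (<-trans j<k (right<end u)))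
    ... | left t = split-left b VF.lv t u v (right<right {a} k<l) P
    ... | peak   = ≮peak (right<end v) (x<w b P)
    ... | right t with pos a m (<-trans j<k (right<end u))
    ...   | left o = right≮left o i<j
    ...   | peak   = ⊥-elim (<-irrefl refl (≤-<-trans (m≤m+n a _) i<j))
    ...   | right o = VF.av (right<right {a} i<j) (right<right {a} j<k) (right<right {a} k<l) v
                        (Pat-map b (inρ⁻ t u) (inρ⁻ u t) (inρ⁻ t v) (inρ⁻ u v) (inρ⁻ v o) P)

  validX : Valid b q n X l
  validX = record { inj = injX ; av = avX ; bnd = bound ; occ = occupied ; anti = antiX ; lv = lvX b onα mode VF.lv }

  f₁-occupied : f₁ ≡ true → 0 < N
  f₁-occupied e = incr-< U↑ (subst₂ _<_ (sym (unskip-zero f₂ _ e (s>0 b q>0)))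
    (trans (sym (+-suc q p)) (sym N≡)) z<s)

  first-top : ∀ {j} → j < m → g j ≡ 0 → l (ρ j) ≡ 0 → f₁ ≡ true
  first-top j<m e e′ = ¬-not λ eq →
    unskip-avoids-0 f₁ f₂ _ eq (s>0 b q>0) _ (trans (sym (sum j<m)) (cong₂ _+_ e e′))

  zero-level : ∀ {j} → j < m → f₁ ≡ true → lF j ≡ 0 → g j ≡ 0 × l (ρ j) ≡ 0
  zero-level {j} j<m e e′ = m+n≡0⇒m≡0 (g j) h , m+n≡0⇒n≡0 (g j) h
    where
    h : g j + l (ρ j) ≡ 0
    h = trans (sum j<m) (trans (cong U e′) (unskip-zero f₂ _ e (s>0 b q>0)))

  max-level : 0 < N → ∀ {j} → j < m → (∀ {k} → k < m → F k ≤ F j) → lF j ≡ 0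
  max-level 0<N {j} j<m mx with VF.occ 0<N
  ... | k , k<m , e with m≤n⇒m<n∨m≡n (mx k<m)
  ...   | inj₁ lt = n≤0⇒n≡0 (≤-trans (VF.anti k<m j<m lt) (≤-reflexive e))
  ...   | inj₂ eq with refl ← VF.inj k<m j<m eq = e

  -- A letter that forms a step with the maximum lies above α in level 0, hence has index 0. Both
  -- sides of this criterion depend only on the tree and on the subword ρ.
  StepAtMax : Set
  StepAtMax = f₁ ≡ true × 0 < m × RL m F 0

  step-max : 0 < m → Stp n X l a (a + 1) → StepAtMax
  step-max 0<m (stp _ same none) = first-top 0<m g0 (trans same onMax) , 0<m , rl
    where
    g0 : g 0 ≡ 0
    g0 = 0<-or (g 0) (λ e → e) (λ o → let (i , i<a , lt) = below-some 0<m o in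
           ⊥-elim (none (left<end i<a) lt (maxα i<a)))
    rl : RL m F 0
    rl {k} 0<k k<m with <-cmp (F k) (F 0)
    ... | tri< t _ _ = t
    ... | tri≈ _ t _ = <⇒≢′ 0<k (sym (VF.inj k<m 0<m t))
    ... | tri> _ _ t = ⊥-elim (none (right<end k<m) (inρ 0<m k<m t) (maxρ k<m))

  step-max⁻ : StepAtMax → Stp n X l a (a + 1)
  step-max⁻ (f , 0<m , rl) = stp (maxρ 0<m) (trans (proj₂ z) (sym onMax)) λ k<n → none (pos a m k<n)
    where
    mx : ∀ {k} → k < m → F k ≤ F 0
    mx {zero}  _   = ≤-refl
    mx {suc k} k<m = <⇒≤ (rl z<s k<m)
    z : g 0 ≡ 0 × l (ρ 0) ≡ 0
    z = zero-level 0<m f (max-level (f₁-occupied f) 0<m mx)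
    none : ∀ {k} → Pos a m k → X (a + 1) < X k → X k < X a → ⊥
    none (left u)  x y = asym x (above u 0<m (proj₁ z))
    none peak      x y = <-irrefl refl y
    none (right u) x y = <-irrefl refl (<-≤-trans (inρ⁻ 0<m u x) (mx u))

  -- A mark lies between two letters of α exactly when the letters of ρ in its gap do, and ρ meets
  -- the gap of every mark.
  step-α : ∀ {i} → suc i < a → Stp n X l i (suc i) → Stp (a + p) A (const 0) i (suc i)
  step-α {i} si<a (stp des _ none) = stp (inα⁻ si<a i<a des) refl λ k< → none′ (pos₂ a p k<)
    where
    i<a = <-trans (n<1+n i) si<a
    none′ : ∀ {k} → Pos₂ a p k → A (suc i) < A k → A k < A i → ⊥
    none′ (left u)  x y = none (left<end u) (inα si<a u x) (inα u i<a y)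
    none′ (right u) x y with occ u
    ... | j , j<m , e = none (right<end j<m) (up si<a j<m u e x) (down i<a j<m u e y)

  step-α⁻ : ∀ {i} → suc i < a → Stp (a + p) A (const 0) i (suc i) → Stp n X l i (suc i)
  step-α⁻ {i} si<a (stp des _ none) = stp (inα si<a i<a des) (trans (onα si<a) (sym (onα i<a))) λ k< → none′ (pos a m k<)
    where
    i<a = <-trans (n<1+n i) si<a
    none′ : ∀ {k} → Pos a m k → X (suc i) < X k → X k < X i → ⊥
    none′ (left u)  x y = none (left<end u) (inα⁻ si<a u x) (inα⁻ u i<a y)
    none′ peak      x y = asym y (maxα i<a)
    none′ (right {j} u) x y = go (gap (g≤ u)) refl
      where
      go : ∀ {x} → Gap p x → g j ≡ x → ⊥
      go top     e = asym y (above i<a u e)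
      go bot     e = asym x (below si<a u e)
      go (mid o) e = none (+-monoʳ-< a o) (up⁻ si<a u o e x) (down⁻ i<a u o e y)

  -- Letters of α lie between two letters of ρ exactly if the gaps differ. Equality of the merged
  -- levels therefore covers both α and the outer thresholds.
  step-ρ : ∀ {j j′} → j < m → j′ < m → Stp n X l (ρ j) (ρ j′) → Stp m F lF j j′
  step-ρ {j} {j′} j<m j′<m (stp des same none) = stp (inρ⁻ j′<m j<m des)
    (≤-antisym (sum≤⁻ j′<m j<m (≤-reflexive (sym gs)) (≤-reflexive same))
               (sum≤⁻ j<m j′<m (≤-reflexive gs) (≤-reflexive (sym same))))
    (λ k x y → none (right<end k) (inρ j′<m k x) (inρ k j<m y))
    where
    gs : g j ≡ g j′
    gs with m≤n⇒m<n∨m≡n (proj₁ (antiρ j′<m j<m des))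
    ... | inj₂ e = e
    ... | inj₁ lt = let (i , i<a , u , v) = separated j<m j′<m lt in ⊥-elim (none (left<end i<a) u v)

  step-ρ⁻ : ∀ {j j′} → j < m → j′ < m → Stp m F lF j j′ → Stp n X l (ρ j) (ρ j′)
  step-ρ⁻ {j} {j′} j<m j′<m (stp des same none) = stp (inρ j′<m j<m des)
    (≤-antisym (proj₂ (sum≤ j′<m j<m (≤-reflexive same))) (proj₂ (sum≤ j<m j′<m (≤-reflexive (sym same)))))
    λ k< → none′ (pos a m k<)
    where
    gs : g j′ ≡ g j
    gs = ≤-antisym (proj₁ (sum≤ j′<m j<m (≤-reflexive same))) (proj₁ (sum≤ j<m j′<m (≤-reflexive (sym same))))
    none′ : ∀ {k} → Pos a m k → X (ρ j′) < X k → X k < X (ρ j) → ⊥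
    none′ (left u)  x y = sameGap u j′<m j<m gs x y
    none′ peak      x y = asym y (maxρ j<m)
    none′ (right u) x y = none u (inρ⁻ j′<m u x) (inρ⁻ u j<m y)

  -- The level `N` of ρ is the pair of the bottom gap and the level `q`: below all merged thresholds
  -- means below α and below the old thresholds.
  low-ρ : Low q n X l → Low N m F lF
  low-ρ (isLow e n≡ lvl least) = go e (pos a m (≤-reflexive (sym n≡))) n≡ lvl least
    where
    go : ∀ e → Pos a m e → n ≡ suc e → l e ≡ q → (∀ {k} → k < e → X e < X k) → Low N m F lF
    go e (left u) n≡ _ _ = ⊥-elim (<-irrefl (sym n≡) (≤-<-trans u peak<end))
    go e peak _ _ least = asym (least a>0) (maxα a>0)
    go _ (right {j} j<m) n≡ lvl least = isLow j m≡ lN λ k<j → inρ⁻ j<m (<-trans k<j j<m) (least (+-monoʳ-< a (s<s k<j)))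
      where
      m≡ : m ≡ suc j
      m≡ = suc-injective (+-cancelˡ-≡ a _ _ (trans n≡ (sym (+-suc a (suc j)))))
      g≡ : g j ≡ suc p
      g≡ with m≤n⇒m<n∨m≡n (g≤ j<m)
      ... | inj₂ e = e
      ... | inj₁ lt = let (i , i<a , u) = above-some j<m (s≤s⁻¹ lt) in asym u (least (<-≤-trans i<a (m≤m+n a _)))
      lN : lF j ≡ N
      lN = incr-inj U↑ (trans (sym (sum j<m)) (trans (cong₂ _+_ g≡ lvl) (trans (+-comm (suc p) q) (sym N≡))))

  low-ρ⁻ : Low N m F lF → Low q n X l
  low-ρ⁻ (isLow j m≡ lvl least) = isLow (ρ j) (trans (cong (λ x → a + suc x) m≡) (+-suc a (suc j))) (proj₂ gl)
    λ k< → go (pos a m (<-trans k< (right<end j<m))) k<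
    where
    j<m : j < m
    j<m = ≤-reflexive (sym m≡)
    h : g j + l (ρ j) ≡ suc p + q
    h = trans (sum j<m) (trans (cong U lvl) (trans N≡ (+-comm q (suc p))))
    gl : g j ≡ suc p × l (ρ j) ≡ q
    gl with m≤n⇒m<n∨m≡n (g≤ j<m)
    ... | inj₁ lt = <⇒≢′ (+-mono-<-≤ lt (l≤ j<m)) h
    ... | inj₂ e  = e , +-cancelˡ-≡ (suc p) _ _ (subst (λ x → x + l (ρ j) ≡ suc p + q) e h)
    go : ∀ {k} → Pos a m k → k < ρ j → X (ρ j) < X k
    go (left u)  _ = below u j<m (proj₁ gl)
    go peak      _ = maxρ j<m
    go (right u) k< = inρ j<m u (least (right<right {a} k<))

module FirstFacts {b} f {m N q} (X l : Seq) {lF}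
  (q≡ : q ≡ skip f 0 N) (l0 : l 0 ≡ 0) (mx : ∀ {j} → j < m → X (suc j) < X 0)
  (ls : ∀ {j} → j < m → l (suc j) ≡ skip f 0 (lF j)) (vF : Valid b N m (X ∘ suc) lF) where

  private module VF = Valid vF

  V↑ : Increasing (skip f 0)
  V↑ = skip-incr f 0

  ≮max : ∀ {i} → i < suc m → X 0 < X i → ⊥
  ≮max {zero}  _ lt = <-irrefl refl lt
  ≮max {suc i} p lt = asym lt (mx (s<s⁻¹ p))

  ls-≤ : ∀ {i j} → i < m → j < m → lF i ≤ lF j → l (suc i) ≤ l (suc j)
  ls-≤ i j h = subst₂ _≤_ (sym (ls i)) (sym (ls j)) (incr-mono-≤ V↑ h)

  ls-< : ∀ {j} → j < m → l (suc j) < q → lF j < N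
  ls-< j h = incr-< V↑ (subst₂ _<_ (ls j) q≡ h)

  occupied : ∀ {c} → c < q → ∃ λ j → j < suc m × l j ≡ c
  occupied {zero}  _ = 0 , z<s , l0
  occupied {suc c} c<q with skip-onto f 0 (suc c) (λ _ ())
  ... | d , e with VF.occ (incr-< V↑ (subst₂ _<_ (sym e) q≡ c<q))
  ... | j , j<m , e′ = suc j , s<s j<m , trans (ls j<m) (trans (cong (skip f 0) e′) e)

  lvX : ∀ b → LvCond b N m (X ∘ suc) lF → LvCond b q (suc m) X l
  lvX true  lvF {zero}  {suc j} i<j j<n _ _ = mx (s<s⁻¹ j<n)
  lvX true  lvF {suc i} {suc j} i<j j<n li lj =
    lvF (s<s⁻¹ i<j) (s<s⁻¹ j<n) (ls-< (<-trans (s<s⁻¹ i<j) (s<s⁻¹ j<n)) li) (ls-< (s<s⁻¹ j<n) lj)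
  lvX false lvF {zero}  {suc j} i<j j<n = ≤-trans (≤-reflexive l0) z≤n
  lvX false lvF {suc i} {suc j} i<j j<n =
    ls-≤ (<-trans (s<s⁻¹ i<j) (s<s⁻¹ j<n)) (s<s⁻¹ j<n) (lvF (s<s⁻¹ i<j) (s<s⁻¹ j<n))

  injX : Inj (suc m) X
  injX {zero}  {zero}  _ _ _ = refl
  injX {zero}  {suc j} _ p e = <⇒≢′ (mx (s<s⁻¹ p)) (sym e)
  injX {suc i} {zero}  p _ e = <⇒≢′ (mx (s<s⁻¹ p)) e
  injX {suc i} {suc j} p r e = cong suc (VF.inj (s<s⁻¹ p) (s<s⁻¹ r) e)

  avX : Av b (suc m) X
  avX {zero} i<j j<k k<l l<n P = ≮max l<n (x<w b P)
  avX {suc i} {suc j} {suc k} {suc l} i<j j<k k<l l<n P =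
    VF.av (s<s⁻¹ i<j) (s<s⁻¹ j<k) (s<s⁻¹ k<l) (s<s⁻¹ l<n) P

  bound : ∀ {i} → i < suc m → l i ≤ q
  bound {zero}  _ = ≤-trans (≤-reflexive l0) z≤n
  bound {suc i} p = subst₂ _≤_ (sym (ls (s<s⁻¹ p))) (sym q≡) (incr-mono-≤ V↑ (VF.bnd (s<s⁻¹ p)))

  antiX : ∀ {i j} → i < suc m → j < suc m → X i < X j → l j ≤ l i
  antiX {j = zero} _ _ _ = subst (_≤ l _) (sym l0) z≤n
  antiX {zero}  {suc j} _ p lt = ⊥-elim (≮max p lt)
  antiX {suc i} {suc j} p r lt = ls-≤ (s<s⁻¹ r) (s<s⁻¹ p) (VF.anti (s<s⁻¹ p) (s<s⁻¹ r) lt)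

  validX : Valid b q (suc m) X l
  validX = record { inj = injX ; av = avX ; bnd = bound ; occ = occupied ; anti = antiX ; lv = lvX b VF.lv }

  StepAtMax : Set
  StepAtMax = f ≡ true × RL m (X ∘ suc) 0

  step-max : 0 < m → Stp (suc m) X l 0 1 → StepAtMax
  step-max 0<m (stp _ same none) = is-true f (trans (sym (ls 0<m)) (trans same l0)) , rl
    where
    is-true : ∀ f → skip f 0 (lF 0) ≡ 0 → f ≡ true
    is-true true _ = refl
    rl : RL m (X ∘ suc) 0
    rl {k} 0<k k<m with <-cmp (X (suc k)) (X 1)
    ... | tri< t _ _ = t
    ... | tri≈ _ t _ = <⇒≢′ 0<k (sym (VF.inj k<m 0<m t))
    ... | tri> _ _ t = ⊥-elim (none (s<s k<m) t (mx k<m))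

  step-max⁻ : 0 < m → StepAtMax → Stp (suc m) X l 0 1
  step-max⁻ 0<m (f≡ , rl) = stp (mx 0<m) (trans (ls 0<m) (trans (cong₂ (λ f → skip f 0) f≡ lF0) (sym l0))) none
    where
    -- The first letter of the tail is its largest one, and if there is a threshold at all, level 0
    -- is occupied and so contains the largest letter.
    lF0 : lF 0 ≡ 0
    lF0 = 0<-or N (λ e → n≤0⇒n≡0 (subst (lF 0 ≤_) e (VF.bnd 0<m))) max-letter
      where
      max-letter : 0 < N → lF 0 ≡ 0
      max-letter o with VF.occ o
      ... | zero  , _ , e = e
      ... | suc k , k< , e = n≤0⇒n≡0 (≤-trans (VF.anti k< 0<m (rl z<s k<)) (≤-reflexive e))
    none : ∀ {k} → k < suc m → X 1 < X k → X k < X 0 → ⊥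
    none {zero}        _ _ y = <-irrefl refl y
    none {suc zero}    _ x _ = <-irrefl refl x
    none {suc (suc k)} p x _ = asym x (rl z<s (s<s⁻¹ p))

  step-F : ∀ {i j} → i < m → j < m → Stp (suc m) X l (suc i) (suc j) → Stp m (X ∘ suc) lF i j
  step-F i j (stp des same none) =
    stp des (incr-inj V↑ (trans (sym (ls j)) (trans same (ls i)))) (λ k → none (s<s k))

  step-F⁻ : ∀ {i j} → i < m → j < m → Stp m (X ∘ suc) lF i j → Stp (suc m) X l (suc i) (suc j)
  step-F⁻ {i} {j} i< j< (stp des same none) =
    stp des (trans (ls j<) (trans (cong (skip f 0) same) (sym (ls i<)))) none′
    where
    none′ : ∀ {k} → k < suc m → X (suc j) < X k → X k < X (suc i) → ⊥
    none′ {zero}  _ _ y = asym y (mx i<)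
    none′ {suc k} p x y = none (s<s⁻¹ p) x y

  low-F : ∀ {e} → suc m ≡ suc (suc e) → l (suc e) ≡ q → (∀ {k} → k < suc e → X (suc e) < X k) →
          Low N m (X ∘ suc) lF
  low-F {e} m≡ lvl least = isLow e (suc-injective m≡)
    (incr-inj V↑ (trans (sym (ls (≤-reflexive (sym (suc-injective m≡))))) (trans lvl q≡))) (λ k → least (s<s k))

  low-F⁻ : Low N m (X ∘ suc) lF → Low q (suc m) X l
  low-F⁻ (isLow e m≡ lvl least) =
    isLow (suc e) (cong suc m≡) (trans (ls e<m) (trans (cong (skip f 0) lvl) (sym q≡))) least′
    where
    e<m : e < m
    e<m = ≤-reflexive (sym m≡)
    least′ : ∀ {k} → k < suc e → X (suc e) < X k
    least′ {zero}  _ = mx e<m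
    least′ {suc k} p = least (s<s⁻¹ p)

-- Validity of encoded words, and statistics shared by two readings

valid : ∀ {b t q n X l} → Enc b t q n X l → Valid b q n X l
valid nil = record { inj = λ () ; av = λ _ _ _ () ; bnd = λ () ; occ = λ () ; anti = λ () ; lv = lvNil _ }
  where
  lvNil : ∀ b {X l} → LvCond b 0 0 X l
  lvNil true  _ ()
  lvNil false _ ()
valid (first refl q≡ l0 mx ls eF) = FirstFacts.validX _ _ _ q≡ l0 mx ls (valid eF)
valid (node refl nd lvs eA eF) = NodeFacts.validX nd lvs (valid eA) (valid eF)

-- The kinds may differ. A common tree puts each position or adjacent pair into the same case, where
-- the statistic is a matter of the flags or of a single subword.
imp : ∀ {b b′ t q n X l Y l′} → Enc b t q n X l → Enc b′ t q n Y l′ → Imp q n X l Y l′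
imp nil nil = record { des = λ _ () ; rl = λ () ; step = λ _ () ; low = λ { (isLow _ () _ _) } }
imp {X = X} {l} {Y} {l′} (first {f} {m} {q = q} refl q≡ l0 mx ls eF) (first _ q≡′ l0′ mx′ ls′ eF′) =
  record { des = des ; rl = rl ; step = step ; low = lo }
  where
  module I = Imp (imp eF eF′)
  module FX = FirstFacts f X l q≡ l0 mx ls (valid eF)
  module FY = FirstFacts f Y l′ q≡′ l0′ mx′ ls′ (valid eF′)
  des : ∀ {i i′} → suc i ≡ i′ → i′ < suc m → X i′ < X i → Y i′ < Y i
  des {zero}  refl p _ = mx′ (s<s⁻¹ p)
  des {suc i} refl p d = I.des refl (s<s⁻¹ p) d
  rl : ∀ {i} → i < suc m → RL (suc m) X i → RL (suc m) Y i
  rl {zero}  _ _ {suc k} _ p = mx′ (s<s⁻¹ p)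
  rl {suc i} p r {suc k} u v = I.rl (s<s⁻¹ p) (λ u v → r (s<s u) (s<s v)) (s<s⁻¹ u) (s<s⁻¹ v)
  step : ∀ {i i′} → suc i ≡ i′ → i′ < suc m → Stp (suc m) X l i i′ → Stp (suc m) Y l′ i i′
  step {zero} refl p s with FX.step-max (s<s⁻¹ p) s
  ... | f≡ , r = FY.step-max⁻ (s<s⁻¹ p) (f≡ , λ u v → I.rl (s<s⁻¹ p) (λ u v → r u v) u v)
  step {suc i} refl p s = FY.step-F⁻ i<m (s<s⁻¹ p) (I.step refl (s<s⁻¹ p) (FX.step-F i<m (s<s⁻¹ p) s))
    where
    i<m = <-trans (n<1+n i) (s<s⁻¹ p)
  lo : Low q (suc m) X l → Low q (suc m) Y l′
  lo (isLow zero e lvl _) = isLow zero e (trans l0′ (trans (sym l0) lvl)) (λ ())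
  lo (isLow (suc e) m≡ lvl least) = FY.low-F⁻ (I.low (FX.low-F m≡ lvl least))
imp {X = X} {l} {Y} {l′} (node {a} {m} {q = q} refl nd lvs eA eF) (node _ nd′ lvs′ eA′ eF′) =
  record { des = λ e p → des (adj a m e p) ; rl = λ p → rl (pos a m p)
         ; step = λ e p → step (adj a m e p) ; low = λ w → NY.low-ρ⁻ (IF.low (NX.low-ρ w)) }
  where
  module IA = Imp (imp eA eA′)
  module IF = Imp (imp eF eF′)
  module NX = NodeFacts nd lvs (valid eA) (valid eF)
  module NY = NodeFacts nd′ lvs′ (valid eA′) (valid eF′)
  module DX = Node nd
  module DY = Node nd′
  n = a + suc m
  pred< : ∀ {j k} → suc j < k → j < k
  pred< = <-trans (n<1+n _)
  des : ∀ {i i′} → Adj a m i i′ → X i′ < X i → Y i′ < Y i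
  des (left u)  d = DY.inα u (pred< u) (IA.des refl (left<end u) (NX.inα⁻ u (pred< u) d))
  des (rise refl) d = asym d (DX.maxα ≤-refl)
  des (fall u)  d = DY.maxρ u
  des (right u) d = DY.inρ u (pred< u) (IF.des refl u (NX.inρ⁻ u (pred< u) d))
  rl : ∀ {i} → Pos a m i → RL n X i → RL n Y i
  rl (left u) r = asym (DX.maxα u) (r u peak<end)
  rl peak     r {k} a<k k<n = go (pos a m k<n) a<k
    where
    go : ∀ {k} → Pos a m k → a < k → Y k < Y a
    go (left u)  _   = DY.maxα u
    go peak      a<k = ⊥-elim (<-irrefl refl a<k)
    go (right u) _   = DY.maxρ u
  rl (right {j} u) r {k} j<k k<n = go (pos a m k<n) j<k
    where
    go : ∀ {k} → Pos a m k → a + suc j < k → Y k < Y (a + suc j)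
    go (left v)  lt = right≮left v lt
    go peak      lt = ⊥-elim (<-irrefl refl (≤-<-trans (m≤m+n a _) lt))
    go (right v) lt = DY.inρ v u (IF.rl u
      (λ j<k k<m → NX.inρ⁻ k<m u (r (+-monoʳ-< a (s<s j<k)) (right<end k<m))) (right<right {a} lt) v)
  step : ∀ {i i′} → Adj a m i i′ → Stp n X l i i′ → Stp n Y l′ i i′
  step (left u)    s = NY.step-α⁻ u (IA.step refl (left<end u) (NX.step-α u s))
  step (rise refl) s = asym (Stp.des s) (DX.maxα ≤-refl)
  step (fall u)    s with NX.step-max u s
  ... | f≡ , _ , r = NY.step-max⁻ (f≡ , u , λ j k → IF.rl u (λ j k → r j k) j k)
  step (right u)   s = NY.step-ρ⁻ (pred< u) u (IF.step refl u (NX.step-ρ (pred< u) u s))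

-- Uniqueness of words and trees

record Same (n : ℕ) (X l Y l′ : Seq) : Set where
  constructor same
  field
    ord : ∀ {i j} → i < n → j < n → X i < X j → Y i < Y j
    lvl : ∀ {i} → i < n → l i ≡ l′ i

ord⁻ : ∀ {n X l Y l′} → Inj n X → Same n X l Y l′ → ∀ {i j} → i < n → j < n → Y i < Y j → X i < X j
ord⁻ {Y = Y} inj s i j = reflect (λ e → cong Y (inj i j e)) (Same.ord s j i)

-- Equal levels inside ρ give equal sums, hence equal gaps and levels on the chain; A then decides
-- how α compares with the marked gaps.
det : ∀ {b t q n X l Y l′} → Enc b t q n X l → Enc b t q n Y l′ → Same n X l Y l′
det nil nil = same (λ ()) (λ ())
det {X = X} {l} {Y} {l′} (first {m = m} refl q≡ l0 mx ls eF) (first _ q≡′ l0′ mx′ ls′ eF′) = same ord lvl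
  where
  module S = Same (det eF eF′)
  ord : ∀ {i j} → i < suc m → j < suc m → X i < X j → Y i < Y j
  ord {zero}  {j}     p r lt = ⊥-elim (FirstFacts.≮max _ X l q≡ l0 mx ls (valid eF) r lt)
  ord {suc i} {zero}  p r lt = mx′ (s<s⁻¹ p)
  ord {suc i} {suc j} p r lt = S.ord (s<s⁻¹ p) (s<s⁻¹ r) lt
  lvl : ∀ {i} → i < suc m → l i ≡ l′ i
  lvl {zero}  _ = trans l0 (sym l0′)
  lvl {suc i} p = trans (ls (s<s⁻¹ p)) (trans (cong (skip _ 0) (S.lvl (s<s⁻¹ p))) (sym (ls′ (s<s⁻¹ p))))
det {b} {X = X} {l} {Y} {l′} (node {a} {m} {p} {g = g} refl nd lvs eA eF) (node {g = g′} _ nd′ lvs′ eA′ eF′) =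
  same (λ i j → ord (pos a m i) (pos a m j)) (λ i → lvl (pos a m i))
  where
  module SA = Same (det eA eA′)
  module SF = Same (det eF eF′)
  module NX = NodeFacts nd lvs (valid eA) (valid eF)
  module DX = Node nd
  module DY = Node nd′
  module LX = Levels lvs
  module LY = Levels lvs′
  gl : ∀ {j} → j < m → _
  gl {j} j<m = mode-mono b (DX.g≤ j<m) (LX.l≤ j<m) (DY.g≤ j<m) (LY.l≤ j<m) (LX.mode j<m) (LY.mode j<m)
                 (≤-reflexive sums) ,
               mode-mono b (DY.g≤ j<m) (LY.l≤ j<m) (DX.g≤ j<m) (LX.l≤ j<m) (LY.mode j<m) (LX.mode j<m)
                 (≤-reflexive (sym sums))
    where
    sums = trans (LX.sum j<m) (trans (cong NX.U (SF.lvl j<m)) (sym (LY.sum j<m)))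
  g≡ : ∀ {j} → j < m → g j ≡ g′ j
  g≡ j<m = ≤-antisym (proj₁ (proj₁ (gl j<m))) (proj₁ (proj₂ (gl j<m)))
  mark : ∀ {k} → k < p → a + k < a + p
  mark = +-monoʳ-< a
  ord : ∀ {i j} → Pos a m i → Pos a m j → X i < X j → Y i < Y j
  ord (left u)  (left v)  lt = DY.inα u v (SA.ord (left<end u) (left<end v) (NX.inα⁻ u v lt))
  ord (left u)  peak      lt = DY.maxα u
  ord (left {i} u) (right {j} v) lt = go (gap (DX.g≤ v)) refl
    where
    go : ∀ {x} → Gap p x → g j ≡ x → Y i < Y (a + suc j)
    go top     e = DY.above u v (trans (sym (g≡ v)) e)
    go bot     e = asym lt (DX.below u v e)
    go (mid o) e = DY.up u v o (trans (sym (g≡ v)) e) (SA.ord (left<end u) (mark o) (NX.up⁻ u v o e lt))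
  ord peak      v         lt = ⊥-elim (NX.≮peak (end v) lt)
    where
    end : ∀ {j} → Pos a m j → j < a + suc m
    end (left u)  = left<end u
    end peak      = peak<end
    end (right u) = right<end u
  ord (right {i} u) (left {j} v) lt = go (gap (DX.g≤ u)) refl
    where
    go : ∀ {x} → Gap p x → g i ≡ x → Y (a + suc i) < Y j
    go top     e = asym lt (DX.above v u e)
    go bot     e = DY.below v u (trans (sym (g≡ u)) e)
    go (mid o) e = DY.down v u o (trans (sym (g≡ u)) e) (SA.ord (mark o) (left<end v) (NX.down⁻ v u o e lt))
  ord (right u) peak      lt = DY.maxρ u
  ord (right u) (right v) lt = DY.inρ u v (SF.ord u v (NX.inρ⁻ u v lt))
  lvl : ∀ {i} → Pos a m i → l i ≡ l′ i
  lvl (left u)  = trans (LX.onα u) (sym (LY.onα u))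
  lvl peak      = trans LX.onMax (sym LY.onMax)
  lvl (right u) = ≤-antisym (proj₂ (proj₁ (gl u))) (proj₂ (proj₂ (gl u)))

same-sym : ∀ {n X l Y l′} → Inj n X → Same n X l Y l′ → Same n Y l′ X l
same-sym inj s = same (ord⁻ inj s) (λ i → sym (Same.lvl s i))

skipped< : ∀ b {q} p → 0 < q → skipped b q p < q + suc p
skipped< true  p o = m<m+n _ z<s
skipped< false p o = m<n+m (suc p) o

module SameNode {b b′ q a m p p′ N N′ f₁ f₁′ f₂ f₂′ X l A A′ F F′ lF lF′ g g′ Y l′}
  (nd : Node a m p X A F g) (lvs : Levels b q a m p N f₁ f₂ l g lF)
  (vA : Valid b 0 (a + p) A (const 0)) (vF : Valid b N m F lF)
  (nd′ : Node a m p′ Y A′ F′ g′) (lvs′ : Levels b′ q a m p′ N′ f₁′ f₂′ l′ g′ lF′)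
  (vA′ : Valid b′ 0 (a + p′) A′ (const 0)) (vF′ : Valid b′ N′ m F′ lF′)
  (X≈Y : Same (a + suc m) X l Y l′) where

  private
    module NX = NodeFacts nd lvs vA vF
    module NY = NodeFacts nd′ lvs′ vA′ vF′
    module DX = Node nd
    module DY = Node nd′
    module LX = Levels lvs
    module LY = Levels lvs′
    module S = Same X≈Y
    a>0 = NX.a>0

  ⟸ : ∀ {i j} → i < a + suc m → j < a + suc m → Y i < Y j → X i < X j
  ⟸ = ord⁻ NX.injX X≈Y

  -- Both `g` and `g′` number the gaps of the same α that ρ meets. If `g′ j` were too large, the gap
  -- just above it in the second numbering would hold a letter that the first numbering also places
  -- strictly above the letter `j`, and the induction bounds its number.
  gap≤ : ∀ k {j} → j < m → g j ≤ k → k ≤ p → g′ j ≤ k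
  gap≤ k {j} j<m gj k≤p = ≮⇒≥ λ lt → go k gj k≤p (gap (DY.g≤ j<m)) refl lt
    where
    go : ∀ k → g j ≤ k → k ≤ p → ∀ {x} → Gap p′ x → g′ j ≡ x → k < x → ⊥
    go k gj k≤p bot e _ =
      let (i , i<a , u) = NX.above-some j<m (≤-trans gj k≤p)
      in asym (S.ord (left<end i<a) (right<end j<m) u) (DY.below i<a j<m e)
    go zero gj _ (mid _) e _ =
      let (i , i<a , u) = NY.below-some j<m (subst (0 <_) (sym e) z<s)
      in asym (⟸ (right<end j<m) (left<end i<a) u) (DX.above i<a j<m (n≤0⇒n≡0 gj))
    go (suc k) gj k≤p (mid {suc x} x<p) e lt with DY.occ (<-trans (n<1+n x) x<p)
    ... | j₁ , j₁<m , e₁ with NY.separated j₁<m j<m (subst₂ _<_ (sym e₁) (sym e) (n<1+n (suc x)))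
    ...   | i , i<a , u , v = <-irrefl refl (<-≤-trans (s<s⁻¹ lt) (≤-trans (≤-reflexive (sym e₁)) (gap≤ k j₁<m g₁≤k (<⇒≤ k≤p))))
      where
      u′ = ⟸ (right<end j<m) (left<end i<a) u
      v′ = ⟸ (left<end i<a) (right<end j₁<m) v
      g₁≤k : g j₁ ≤ k
      g₁≤k with m≤n⇒m<n∨m≡n (proj₁ (NX.antiρ j<m j₁<m (<-trans u′ v′)))
      ... | inj₁ lt = s≤s⁻¹ (<-≤-trans lt gj)
      ... | inj₂ e = ⊥-elim (NX.sameGap i<a j<m j₁<m (sym e) u′ v′)
    go (suc k) gj k≤p (mid {zero} _) e (s≤s ())

  p′≤p : p′ ≤ p
  p′≤p = ≮⇒≥ λ p<p′ → let (j , j<m , e) = DY.occ p<p′ in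
    <-irrefl refl (≤-trans (≤-reflexive (sym e)) (gap≤ p j<m (not-bottom p<p′ j<m e) ≤-refl))
    where
    not-bottom : ∀ {j} → p < p′ → j < m → g′ j ≡ suc p → g j ≤ p
    not-bottom p<p′ j<m e = let (i , i<a , u) = NY.above-some j<m (≤-trans (≤-reflexive e) p<p′) in
      NX.gap≤p i<a j<m (⟸ (left<end i<a) (right<end j<m) u)

  g′≤g : p ≡ p′ → ∀ {j} → j < m → g′ j ≤ g j
  g′≤g refl {j} j<m with m≤n⇒m<n∨m≡n (DX.g≤ j<m)
  ... | inj₁ lt = gap≤ (g j) j<m ≤-refl (s≤s⁻¹ lt)
  ... | inj₂ e  = ≤-trans (DY.g≤ j<m) (≤-reflexive (sym e))

  l′≡l : ∀ {j} → j < m → l′ (a + suc j) ≡ l (a + suc j)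
  l′≡l j<m = sym (S.lvl (right<end j<m))

  f₁-imp : f₁ ≡ true → f₁′ ≡ true
  f₁-imp e with NX.U-occ {0} (subst (0 <_) (sym (+-suc q p)) z<s) (λ e′ → not-both e e′) (λ e′ → <⇒≢ (s>0 b LX.q>0 e′))
    where
    not-both : ∀ {f} {C : Set} → f ≡ true → f ≡ false → C
    not-both refl ()
  ... | j , j<m , z = NY.first-top j<m (n≤0⇒n≡0 (gap≤ 0 j<m (≤-reflexive (m+n≡0⇒m≡0 (g j) z)) z≤n))
                        (trans (l′≡l j<m) (m+n≡0⇒n≡0 (g j) z))

  -- The level of α belongs to the word, but it is `q` for 1423 and 0 for 2413: readings of
  -- different kinds agree on it only without thresholds.
  kinds : b ≡ b′ ⊎ q ≡ 0
  kinds = go b b′ (trans (sym (LX.onα NX.a>0)) (trans (S.lvl (left<end NX.a>0)) (LY.onα NX.a>0)))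
    where
    go : ∀ b b′ → αlevel b q ≡ αlevel b′ q → b ≡ b′ ⊎ q ≡ 0
    go true  true  _ = inj₁ refl
    go true  false e = inj₂ e
    go false true  e = inj₂ (sym e)
    go false false _ = inj₁ refl

  f₂-imp : p ≡ p′ → (∀ {j} → j < m → g j ≡ g′ j) → f₂ ≡ true → f₂′ ≡ true
  f₂-imp p≡ g≡ e = ¬-not λ e′ → go p≡ e′ kinds
    where
    not-both : ∀ {f} {C : Set} → f ≡ true → f ≡ false → C
    not-both refl ()
    go : p ≡ p′ → f₂′ ≡ false → b ≡ b′ ⊎ q ≡ 0 → ⊥
    go _    e′ (inj₂ q≡0) = <⇒≢′ (LY.q>0 e′) (sym q≡0)
    go refl e′ (inj₁ refl) with NX.U-occ (skipped< b p (LY.q>0 e′)) (λ _ z → <⇒≢ (s>0 b {p = p} LY.q>0 e′) (sym z)) (λ e″ → not-both e e″)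
    ... | j , j<m , z = unskip-avoids-s f₁′ f₂′ _ e′ _
            (trans (sym (LY.sum j<m)) (trans (cong₂ _+_ (sym (g≡ j<m)) (l′≡l j<m)) z))

  -- The corner depends on the kind. If the kinds differ, `q` is 0, so `f₂` is true and the corner
  -- is not cut out.
  unskips : p ≡ p′ → f₁ ≡ f₁′ → f₂ ≡ f₂′ → ∀ c → NX.U c ≡ NY.U c
  unskips refl refl refl c = go kinds
    where
    any : ∀ f → (f ≡ false → 0 < q) → q ≡ 0 → ∀ s s′ → unskip f₁ f s c ≡ unskip f₁ f s′ c
    any true  _ _ s s′ = refl
    any false o e s s′ = <⇒≢′ (o refl) (sym e)
    go : b ≡ b′ ⊎ q ≡ 0 → NX.U c ≡ NY.U c
    go (inj₁ refl) = refl
    go (inj₂ e)    = any f₂ LX.q>0 e _ _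

  sameA : p ≡ p′ → (∀ {j} → j < m → g j ≡ g′ j) → Same (a + p) A (const 0) A′ (const 0)
  sameA refl g≡ = same (λ i j → go (pos₂ a p i) (pos₂ a p j)) (λ _ → refl)
    where
    go : ∀ {i j} → Pos₂ a p i → Pos₂ a p j → A i < A j → A′ i < A′ j
    go (left u)  (left v)  lt = NY.inα⁻ u v (S.ord (left<end u) (left<end v) (DX.inα u v lt))
    go (left u)  (right v) lt with DX.occ v
    ... | j , j<m , e = NY.up⁻ u j<m v (trans (sym (g≡ j<m)) e)
                          (S.ord (left<end u) (right<end j<m) (DX.up u j<m v e lt))
    go (right u) (left v)  lt with DX.occ u
    ... | j , j<m , e = NY.down⁻ v j<m u (trans (sym (g≡ j<m)) e)
                          (S.ord (right<end j<m) (left<end v) (DX.down v j<m u e lt))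
    go (right {k} u) (right {k′} v) lt with <-cmp k k′
    ... | tri< k<k′ _ _ = asym lt (NX.dec k<k′ v)
    ... | tri≈ _ refl _ = ⊥-elim (<-irrefl refl lt)
    ... | tri> _ _ k′<k = NY.dec k′<k u

  sameF : (∀ c → NX.U c ≡ NY.U c) → (∀ {j} → j < m → g j ≡ g′ j) → Same m F lF F′ lF′
  sameF U≡ g≡ = same (λ i j lt → NY.inρ⁻ i j (S.ord (right<end i) (right<end j) (DX.inρ i j lt)))
    λ {j} j<m → incr-inj NX.U↑ (trans (sym (LX.sum j<m)) (trans (cong₂ _+_ (g≡ j<m) (sym (l′≡l j<m)))
                  (trans (LY.sum j<m) (sym (U≡ _)))))

bool-ext : ∀ {f f′} → (f ≡ true → f′ ≡ true) → (f′ ≡ true → f ≡ true) → f ≡ f′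
bool-ext {true}  {_}     h _ = sym (h refl)
bool-ext {false} {true}  _ h = h refl
bool-ext {false} {false} _ _ = refl

maxPos : Tree → ℕ
maxPos nil                        = 0
maxPos (first _ _ _ _)            = 0
maxPos (node a _ _ _ _ _ _ _)     = a

maxPos-max : ∀ {b t q n X l} → Enc b t q n X l → ∀ {k} → k < n → k ≢ maxPos t → X k < X (maxPos t)
maxPos-max (first refl _ _ mx _ _) {zero}  _ ne = ⊥-elim (ne refl)
maxPos-max (first refl _ _ mx _ _) {suc k} p _  = mx (s<s⁻¹ p)
maxPos-max (node {a} {m} refl nd _ _ _) p ne with pos a m p
... | left u  = Node.maxα nd u
... | peak    = ⊥-elim (ne refl)
... | right u = Node.maxρ nd u

maxPos< : ∀ {b t q n X l} → Enc b t q n X l → 0 < n → maxPos t < n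
maxPos< nil ()
maxPos< (first refl _ _ _ _ _) _ = z<s
maxPos< (node refl _ _ _ _) _ = peak<end

maxPos-same : ∀ {b b′ t t′ q n X l Y l′} → Enc b t q n X l → Enc b′ t′ q n Y l′ → Same n X l Y l′ →
              0 < n → maxPos t ≡ maxPos t′
maxPos-same {t = t} {t′} e e′ s 0<n with maxPos t ≟ maxPos t′
... | yes eq = eq
... | no ne  = asym (maxPos-max e′ (maxPos< e 0<n) ne)
                    (Same.ord s (maxPos< e′ 0<n) (maxPos< e 0<n) (maxPos-max e (maxPos< e′ 0<n) (≢-sym ne)))

first-flag : ∀ {f f′ m N N′ q} {l lF l′ lF′ : Seq} → q ≡ skip f 0 N → q ≡ skip f′ 0 N′ →
  (∀ {c} → c < N → ∃ λ j → j < m × lF j ≡ c) →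
  (∀ {j} → j < m → l (suc j) ≡ skip f 0 (lF j)) → (∀ {j} → j < m → l′ (suc j) ≡ skip f′ 0 (lF′ j)) →
  (∀ {j} → j < m → l (suc j) ≡ l′ (suc j)) → f ≡ true → f′ ≡ true
first-flag {f′ = true}  _ _ _ _ _ _ _ = refl
first-flag {f′ = false} {q = suc _} refl e occ ls ls′ l≡ refl with occ z<s
... | j , j<m , z with trans (sym (trans (ls j<m) z)) (trans (l≡ j<m) (ls′ j<m))
...   | ()

-- The position of the maximum fixes the constructor and `a`. Gap numbers, flags and thresholds are
-- then intrinsic to the levelled word, and so are both subwords up to order.
uniq : ∀ {b b′ t t′ q n X l Y l′} → Enc b t q n X l → Enc b′ t′ q n Y l′ → Same n X l Y l′ → t ≡ t′
uniq nil nil _ = refl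
uniq nil (first () _ _ _ _ _) _
uniq nil (node {zero} () _ _ _ _) _
uniq nil (node {suc a} () _ _ _ _) _
uniq (first () _ _ _ _ _) nil _
uniq (node {zero} () _ _ _ _) nil _
uniq (node {suc a} () _ _ _ _) nil _
uniq {b} {b′} {q = q} {X = X} {l} {Y} {l′} (first {f} {m} {N} {t} {lF = lF} refl q≡ l0 mx ls eF)
     (first {f′} {N = N′} {t′} {lF = lF′} refl q≡′ l0′ mx′ ls′ eF′) s =
  go f≡ q≡′ ls′ eF′
  where
  l≡ : ∀ {j} → j < m → l (suc j) ≡ l′ (suc j)
  l≡ j<m = Same.lvl s (s<s j<m)
  f≡ : f ≡ f′
  f≡ = bool-ext (first-flag {l = l} {lF} {l′} {lF′} q≡ q≡′ (Valid.occ (valid eF)) ls ls′ l≡)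
                (first-flag {l = l′} {lF′} {l} {lF} q≡′ q≡ (Valid.occ (valid eF′)) ls′ ls (λ j → sym (l≡ j)))
  go : ∀ {f′} → f ≡ f′ → q ≡ skip f′ 0 N′ → (∀ {j} → j < m → l′ (suc j) ≡ skip f′ 0 (lF′ j)) →
       Enc b′ t′ N′ m (Y ∘ suc) lF′ → first f m N t ≡ first f′ m N′ t′
  go refl q≡′ ls′ eF′ with refl ← incr-inj (skip-incr f 0) (trans (sym q≡) q≡′) =
    cong (first f m N) (uniq eF eF′ (same (λ i j lt → Same.ord s (s<s i) (s<s j) lt)
      (λ j → incr-inj (skip-incr f 0) (trans (sym (ls j)) (trans (l≡ j) (ls′ j))))))
uniq e@(first refl _ _ _ _ _) e′@(node _ nd _ _ _) s =
  <⇒≢′ (CondFacts.a>0 (Node.cond nd)) (maxPos-same e e′ s z<s)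
uniq e@(node _ nd _ _ _) e′@(first refl _ _ _ _ _) s =
  <⇒≢′ (CondFacts.a>0 (Node.cond nd)) (sym (maxPos-same e e′ s z<s))
uniq e@(node {a} {m} {p} {N} {f₁} {f₂} {tA} {tF} n≡ nd lvs eA eF)
     e′@(node {a′} {m′} {p′} {N′} {f₁′} {f₂′} {tA′} {tF′} n≡′ nd′ lvs′ eA′ eF′) s
  with refl ← maxPos-same e e′ s (subst (0 <_) (sym n≡) (≤-<-trans z≤n peak<end))
  with refl ← n≡
  with refl ← +-cancelˡ-≡ a _ _ n≡′ = go p≡ N≡ f₁≡ f₂≡
  where
  open SameNode nd lvs (valid eA) (valid eF) nd′ lvs′ (valid eA′) (valid eF′) s
  module R = SameNode nd′ lvs′ (valid eA′) (valid eF′) nd lvs (valid eA) (valid eF) (same-sym (Valid.inj (valid e)) s)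
  p≡ : p ≡ p′
  p≡ = ≤-antisym R.p′≤p p′≤p
  g≡ : ∀ {j} → j < m → _
  g≡ j<m = ≤-antisym (R.g′≤g (sym p≡) j<m) (g′≤g p≡ j<m)
  f₁≡ : f₁ ≡ f₁′
  f₁≡ = bool-ext f₁-imp R.f₁-imp
  f₂≡ : f₂ ≡ f₂′
  f₂≡ = bool-ext (f₂-imp p≡ g≡) (R.f₂-imp (sym p≡) (λ j → sym (g≡ j)))
  U≡ = unskips p≡ f₁≡ f₂≡
  N≡ : N ≡ N′
  N≡ = incr-inj (unskip-incr f₁ f₂ _) (trans (Levels.N≡ lvs) (trans (cong (λ p → _ + suc p) p≡)
         (trans (sym (Levels.N≡ lvs′)) (sym (U≡ N′)))))
  sA = sameA p≡ g≡
  sF = sameF U≡ g≡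
  go : p ≡ p′ → N ≡ N′ → f₁ ≡ f₁′ → f₂ ≡ f₂′ → node a m p N f₁ f₂ tA tF ≡ node a m p′ N′ f₁′ f₂′ tA′ tF′
  go refl refl refl refl = cong₂ (node a m p N f₁ f₂) (uniq eA eA′ sA) (uniq eF eF′ sF)

-- Re-reading a tree for a given pattern

-- `high` asks for a right-to-left maximum among the first `a` positions. As the marks descend, a
-- failure of `sep` is a step between neighbouring marks, and a failure of `lowest` is an instance
-- of `Low`; either one would carry over to `A`.
cond-transfer : ∀ {a p A A′} → Cond a p A → Inj (a + p) A′ → Sim 0 (a + p) A (const 0) A′ (const 0) → Cond a p A′
cond-transfer {a} {p} {A} {A′} c inj (fw , bw) = record { high = high′ ; sep = sep′ ; lowest = lowest′ }
  where
  open CondFacts c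
  high′ : ∃ λ i → i < a × RL (a + p) A′ i
  high′ = let (i , i<a , r) = high in i , i<a , λ {k} → Imp.rl fw (left<end i<a) r {k}
  next : ∀ k → suc (a + k) ≡ a + suc k
  next k = sym (+-suc a k)
  dec′ : ∀ {k k′} → k < k′ → k′ < p → A′ (a + k′) < A′ (a + k)
  dec′ = decreasing (A′ ∘ (a +_)) λ {k} h → Imp.des fw (next k) (+-monoʳ-< a h) (dec (n<1+n k) h)
  sep′ : ∀ {k} → suc k < p → ∃ λ i → i < a × A′ (a + suc k) < A′ i × A′ i < A′ (a + k)
  sep′ {k} h with anyUpTo? (λ i → (A′ (a + suc k) <? A′ i) ×-dec (A′ i <? A′ (a + k))) a
  ... | yes r = r
  ... | no ne with sep h
  ...   | i , i<a , u , v = ⊥-elim (Stp.none (Imp.step bw (next k) (+-monoʳ-< a h) step) (left<end i<a) u v)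
    where
    step : Stp (a + p) A′ (const 0) (a + k) (a + suc k)
    step = stp (dec′ (n<1+n k) h) refl λ o → go (pos₂ a p o)
      where
      go : ∀ {x} → Pos₂ a p x → A′ (a + suc k) < A′ x → A′ x < A′ (a + k) → ⊥
      go (left o) x y = ne (_ , o , x , y)
      go (right {j} o) x y with <-cmp j k
      ... | tri< j<k _ _ = asym y (dec′ j<k (<-trans (n<1+n k) h))
      ... | tri≈ _ refl _ = <-irrefl refl y
      ... | tri> _ _ k<j with m≤n⇒m<n∨m≡n k<j
      ...   | inj₁ lt = asym x (dec′ lt o)
      ...   | inj₂ refl = <-irrefl refl x
  lowest′ : ∀ {k} → suc k ≡ p → ∃ λ i → i < a × A′ i < A′ (a + k)
  lowest′ {k} refl with anyUpTo? (λ i → A′ i <? A′ (a + k)) a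
  ... | yes r = r
  ... | no ne with lowest refl | Imp.low bw (isLow (a + k) (+-suc a k) refl λ o → go (pos₂ a k o))
    where
    go : ∀ {x} → Pos₂ a k x → A′ (a + k) < A′ x
    go (left o)  = ≤∧≢⇒< (≮⇒≥ λ lt → ne (_ , o , lt))
      (λ e → <⇒≢′ (<-≤-trans o (m≤m+n a k)) (sym (inj (+-monoʳ-< a (n<1+n k)) (left<end o) e)))
    go (right o) = dec′ o (n<1+n k)
  ... | i , i<a , u | isLow e e≡ _ least with refl ← suc-injective (trans (sym e≡) (+-suc a k)) =
    asym u (least (<-≤-trans i<a (m≤m+n a k)))

join : (a : ℕ) → Seq → ℕ → Seq → Seq
join zero    α x ρ zero    = x
join zero    α x ρ (suc j) = ρ j
join (suc a) α x ρ zero    = α zero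
join (suc a) α x ρ (suc i) = join a (α ∘ suc) x ρ i

join-left : ∀ a {α x ρ i} → i < a → join a α x ρ i ≡ α i
join-left (suc a) {i = zero}  _ = refl
join-left (suc a) {i = suc i} p = join-left a (s<s⁻¹ p)

join-peak : ∀ a {α x ρ} → join a α x ρ a ≡ x
join-peak zero    = refl
join-peak (suc a) = join-peak a

join-right : ∀ a {α x ρ j} → join a α x ρ (a + suc j) ≡ ρ j
join-right zero    = refl
join-right (suc a) = join-right a

bounded : ∀ m (F : Seq) → ∃ λ K → ∀ {j} → j < m → F j < K
bounded zero    F = 0 , λ ()
bounded (suc m) F with bounded m F
... | K , b = suc (F m) ⊔ K , go
  where
  go : ∀ {j} → j < suc m → F j < suc (F m) ⊔ K
  go {j} p with m≤n⇒m<n∨m≡n (s≤s⁻¹ p)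
  ... | inj₁ lt   = <-≤-trans (b lt) (m≤n⊔m (suc (F m)) K)
  ... | inj₂ refl = m≤m⊔n (suc (F m)) K

lex-< : ∀ {u v x y K} → u < v → x < K → u * K + x < v * K + y
lex-< {u} {v} {x} {y} {K} u<v x<K = begin-strict
  u * K + x  <⟨ +-monoʳ-< (u * K) x<K ⟩
  u * K + K  ≡⟨ +-comm (u * K) K ⟩
  suc u * K  ≤⟨ *-monoˡ-≤ K u<v ⟩
  v * K      ≤⟨ m≤m+n (v * K) y ⟩
  v * K + y  ∎
  where open ≤-Reasoning

-- The inverse of (g , l) ↦ g + l on the chain of possible pairs

gapOf levelOf : Bool → (q p h : ℕ) → ℕ
gapOf true  q p h = h ∸ q
gapOf false q p h = h ⊓ suc p
levelOf true  q p h = h ⊓ q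
levelOf false q p h = h ∸ suc p

gap+level : ∀ b q p h → gapOf b q p h + levelOf b q p h ≡ h
gap+level true  q p h = trans (+-comm (h ∸ q) (h ⊓ q)) (trans (cong (_+ (h ∸ q)) (⊓-comm h q)) (m⊓n+n∸m≡n q h))
gap+level false q p h = trans (cong (_+ (h ∸ suc p)) (⊓-comm h (suc p))) (m⊓n+n∸m≡n (suc p) h)

gapOf≤ : ∀ b q p {h} → h ≤ q + suc p → gapOf b q p h ≤ suc p
gapOf≤ true  q p h≤ = m≤n+o⇒m∸n≤o _ q h≤
gapOf≤ false q p h≤ = m⊓n≤n _ (suc p)

levelOf≤ : ∀ b q p {h} → h ≤ q + suc p → levelOf b q p h ≤ q
levelOf≤ true  q p h≤ = m⊓n≤n _ q
levelOf≤ false q p h≤ = m≤n+o⇒m∸n≤o _ (suc p) (≤-trans h≤ (≤-reflexive (+-comm q (suc p))))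

mode-of : ∀ b q p h → Mode b q p (gapOf b q p h) (levelOf b q p h)
mode-of true  q p h o = m≥n⇒m⊓n≡n (<⇒≤ (m∸n≢0⇒n<m (>⇒≢ o)))
mode-of false q p h o = m≥n⇒m⊓n≡n (<⇒≤ (m∸n≢0⇒n<m (>⇒≢ o)))

gapIndex : Bool → (q g : ℕ) → ℕ
gapIndex true  q g = q + g
gapIndex false q g = g

gapOf-index : ∀ b q p {g} → g ≤ p → gapOf b q p (gapIndex b q g) ≡ g
gapOf-index true  q p {g} _ = m+n∸m≡n q g
gapOf-index false q p g≤p = m≤n⇒m⊓n≡m (m≤n⇒m≤1+n g≤p)

gapIndex< : ∀ b q p {g} → g ≤ p → gapIndex b q g < q + suc p
gapIndex< true  q p g≤p = +-monoʳ-< q (s≤s g≤p)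
gapIndex< false q p g≤p = <-≤-trans (s≤s g≤p) (m≤n+m (suc p) q)

gapIndex≢0 : ∀ b q {k} → gapIndex b q (suc k) ≢ 0
gapIndex≢0 true  q {k} e with trans (sym (+-suc q k)) e
... | ()
gapIndex≢0 false q ()

gapIndex≢skipped : ∀ b q p {k} → k < p → gapIndex b q (suc k) ≢ skipped b q p
gapIndex≢skipped true  q p k<p e = <⇒≢′ (m<m+n q z<s) (sym e)
gapIndex≢skipped false q p k<p e = <⇒≢′ (s<s k<p) e

skip-above : ∀ {s c} → s ≤ c → skip false s c ≡ suc c
skip-above {zero}          _       = refl
skip-above {suc s} {suc c} (s≤s h) = cong suc (skip-above h)

skip-below : ∀ {s c} → c < s → skip false s c ≡ c
skip-below {suc s} {zero}  _ = refl
skip-below {suc s} {suc c} h = cong suc (skip-below (s<s⁻¹ h))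

skip-end : ∀ {s s′ c x} → skip false s c ≡ x → s < x → s′ < x → skip false s′ c ≡ x
skip-end {s} {s′} {c} {x} e s<x s′<x with c <? s
... | yes c<s = <⇒≢′ (<-trans c<s s<x) (trans (sym (skip-below c<s)) e)
... | no c≮s  = trans (skip-above (s≤s⁻¹ (<-≤-trans s′<x (≤-reflexive (sym sc≡x))))) sc≡x
  where
  sc≡x : suc c ≡ x
  sc≡x = trans (sym (skip-above (≮⇒≥ c≮s))) e

-- Either corner lies strictly before the end of the chain, so cutting it out shifts the end by one.
-- Hence ρ gets the same number `N` of thresholds for both patterns.
unskip-end : ∀ b b′ f₁ f₂ {q p N} → (f₂ ≡ false → 0 < q) →
             unskip f₁ f₂ (skipped b q p) N ≡ q + suc p → unskip f₁ f₂ (skipped b′ q p) N ≡ q + suc p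
unskip-end b b′ f₁ true  o e = e
unskip-end b b′ f₁ false {p = p} o e = skip-end e (skipped< b p (o refl)) (skipped< b′ p (o refl))

module BuildNode {b q a m p N f₁ f₂ A F lF}
  (c : Cond a p A) (vA : Valid b 0 (a + p) A (const 0)) (vF : Valid b N m F lF)
  (N≡ : unskip f₁ f₂ (skipped b q p) N ≡ q + suc p) (q>0 : f₂ ≡ false → 0 < q) where

  private
    module VA = Valid vA
    module VF = Valid vF
    U = unskip f₁ f₂ (skipped b q p)
    U↑ = unskip-incr f₁ f₂ (skipped b q p)
    BA = bounded (a + p) A
    BF = bounded m F
    K = suc (proj₁ BF)

  -- The level inside ρ gives the index on the chain, which is split into gap and level by the rule
  -- of the kind `b`.
  g lρ : Seq
  g j = gapOf b q p (U (lF j))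
  lρ j = levelOf b q p (U (lF j))

  U≤ : ∀ {j} → j < m → U (lF j) ≤ q + suc p
  U≤ j<m = ≤-trans (incr-mono-≤ U↑ (VF.bnd j<m)) (≤-reflexive N≡)

  g≤ : ∀ {j} → j < m → g j ≤ suc p
  g≤ j<m = gapOf≤ b q p (U≤ j<m)

  g-anti : ∀ {i j} → i < m → j < m → F i < F j → g j ≤ g i
  g-anti {i} {j} i<m j<m lt = proj₁ (mode-mono b (g≤ j<m) (levelOf≤ b q p (U≤ j<m)) (g≤ i<m) (levelOf≤ b q p (U≤ i<m))
    (mode-of b q p _) (mode-of b q p _)
    (≤-trans (≤-reflexive (gap+level b q p _)) (≤-trans (incr-mono-≤ U↑ (VF.anti i<m j<m lt)) (≤-reflexive (sym (gap+level b q p _))))))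

  l : Seq
  l = join a (const (αlevel b q)) 0 lρ

  -- Values are compared lexicographically: first by the gap of α, then by F.
  height : ℕ → ℕ
  height zero = suc (proj₁ BA)
  height (suc k) with k <? p
  ... | yes _ = suc (A (a + k))
  ... | no _  = 0

  height-mid : ∀ {k} → k < p → height (suc k) ≡ suc (A (a + k))
  height-mid {k} k<p with k <? p
  ... | yes _  = refl
  ... | no k≮p = ⊥-elim (k≮p k<p)

  height-bot : height (suc p) ≡ 0
  height-bot with p <? p
  ... | yes h = ⊥-elim (<-irrefl refl h)
  ... | no _  = refl

  open CondFacts c

  height-mono : ∀ {x y} → Gap p x → Gap p y → x < y → height y < height x
  height-mono top     (mid o) _ = subst (_< _) (sym (height-mid o)) (s<s (proj₂ BA (+-monoʳ-< a o)))
  height-mono top     bot     _ = subst (_< _) (sym height-bot) z<s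
  height-mono (mid u) (mid v) h = subst₂ _<_ (sym (height-mid v)) (sym (height-mid u)) (s<s (dec (s<s⁻¹ h) v))
  height-mono (mid u) bot     _ = subst₂ _<_ (sym height-bot) (sym (height-mid u)) z<s
  height-mono bot     (mid v) h = asym v (s<s⁻¹ h)
  height-mono bot     bot     h = ⊥-elim (<-irrefl refl h)

  height≤ : ∀ {x} → Gap p x → height x ≤ suc (proj₁ BA)
  height≤ top     = ≤-refl
  height≤ (mid o) = <⇒≤ (height-mono top (mid o) z<s)
  height≤ bot     = <⇒≤ (height-mono top bot z<s)

  -- `K` exceeds every value of F, so F decides only within a gap. Heights of letters of α are
  -- shifted by one to leave 0 for the bottom gap, and a mark lends its height to its gap.
  X : Seq
  X = join a (λ i → suc (A i) * K + 0) (suc (suc (proj₁ BA)) * K + 0) (λ j → height (g j) * K + F j)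

  F<K : ∀ {j} → j < m → F j < K
  F<K j<m = <-trans (proj₂ BF j<m) (n<1+n _)

  private
    by : ∀ {x y u v r s} → X x ≡ u * K + r → X y ≡ v * K + s → u < v → r < K → X x < X y
    by e e′ h r = subst₂ _<_ (sym e) (sym e′) (lex-< h r)
    α= : ∀ {i} → i < a → X i ≡ suc (A i) * K + 0
    α= = join-left a
    ρ= : ∀ {j} → X (a + suc j) ≡ height (g j) * K + F j
    ρ= = join-right a

  buildNode : Node a m p X A F g
  buildNode = record
    { cond  = c
    ; inα   = λ i j lt → by (α= i) (α= j) (s<s lt) z<s
    ; maxα  = λ i → by (α= i) (join-peak a) (s<s (<-trans (proj₂ BA (left<end i)) (n<1+n _))) z<s
    ; maxρ  = λ j → by ρ= (join-peak a) (s≤s (height≤ (gap (g≤ j)))) (F<K j)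
    ; inρ   = inρ
    ; g≤    = g≤
    ; occ   = occ
    ; above = λ {i} u v e → by (α= u) ρ= (subst (λ x → suc (A i) < height x) (sym e) (s<s (proj₂ BA (left<end u)))) z<s
    ; up    = λ {i} u v k e lt → by (α= u) ρ= (subst (suc (A i) <_) (sym (trans (cong height e) (height-mid k))) (s<s lt)) z<s
    ; down  = λ {i} u v k e lt → by ρ= (α= u) (subst (_< suc (A i)) (sym (trans (cong height e) (height-mid k))) (s<s lt)) (F<K v)
    ; below = λ {i} u v e → by ρ= (α= u) (subst (_< suc (A i)) (sym (trans (cong height e) height-bot)) z<s) (F<K v)
    }
    where
    inρ : ∀ {i j} → i < m → j < m → F i < F j → X (a + suc i) < X (a + suc j)
    inρ {i} {j} i<m j<m lt with m≤n⇒m<n∨m≡n (g-anti i<m j<m lt)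
    ... | inj₁ h = by ρ= ρ= (height-mono (gap (g≤ j<m)) (gap (g≤ i<m)) h) (F<K i<m)
    ... | inj₂ e = subst₂ _<_ (sym ρ=) (sym ρ=)
      (subst (λ x → height (g i) * K + F i < height x * K + F j) (sym e) (+-monoʳ-< (height (g i) * K) lt))
    occ : ∀ {k} → k < p → ∃ λ j → j < m × g j ≡ suc k
    occ {k} k<p with unskip-onto f₁ f₂ (skipped b q p) (gapIndex b q (suc k)) (s>0 b q>0)
                       (λ _ → gapIndex≢0 b q) (λ _ → gapIndex≢skipped b q p k<p)
    ... | d , e with VF.occ (incr-< U↑ (subst₂ _<_ (sym e) (sym N≡) (gapIndex< b q p k<p)))
    ... | j , j<m , lj = j , j<m , trans (cong (gapOf b q p) (trans (cong U lj) e)) (gapOf-index b q p k<p)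

  buildLevels : Levels b q a m p N f₁ f₂ l g lF
  buildLevels = record
    { onα   = join-left a
    ; onMax = join-peak a
    ; sum   = λ {j} _ → trans (cong (g j +_) (join-right a)) (gap+level b q p _)
    ; l≤    = λ j → ≤-trans (≤-reflexive (join-right a)) (levelOf≤ b q p (U≤ j))
    ; mode  = λ {j} _ → subst (Mode b q p (g j)) (sym (join-right a)) (mode-of b q p _)
    ; N≡    = N≡
    ; q>0   = q>0
    }

cons : ℕ → Seq → Seq
cons x F zero    = x
cons x F (suc i) = F i

relevel : ∀ {b t q n X l l′} → (∀ {i} → i < n → l i ≡ l′ i) → Enc b t q n X l → Enc b t q n X l′
relevel l≡ nil = nil
relevel l≡ (first refl q≡ l0 mx ls eF) =
  first refl q≡ (trans (sym (l≡ z<s)) l0) mx (λ j → trans (sym (l≡ (s<s j))) (ls j)) eF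
relevel {b} {q = q} {l′ = l′} l≡ (node {a} {m} {p} {g = g} refl nd lvs eA eF) = node refl nd (record
  { onα   = λ i → trans (sym (l≡ (left<end i))) (L.onα i)
  ; onMax = trans (sym (l≡ peak<end)) L.onMax
  ; sum   = λ {j} u → trans (cong (g j +_) (sym (l≡ (right<end u)))) (L.sum u)
  ; l≤    = λ u → subst (_≤ q) (l≡ (right<end u)) (L.l≤ u)
  ; mode  = λ {j} u → subst (Mode b q p (g j)) (l≡ (right<end u)) (L.mode u)
  ; N≡    = L.N≡
  ; q>0   = L.q>0
  }) eA eF
  where module L = Levels lvs

build : ∀ {b t q n X l} b′ → Enc b t q n X l → Σ Seq λ Y → ∃ λ l′ → Enc b′ t q n Y l′
build b′ nil = const 0 , const 0 , nil
build b′ (first {f} {m} refl q≡ l0 mx ls eF) with build b′ eF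
... | F , lF , eF′ with bounded m F
...   | K , F<K = cons K F , cons 0 (λ j → skip f 0 (lF j)) ,
                  first refl q≡ refl F<K (λ _ → refl) eF′
build {b} b′ (node {a} {p = p} {f₁ = f₁} {f₂} {A = A₀} refl nd lvs eA eF) with build b′ eA | build b′ eF
... | A , lA , eA′ | F , lF , eF′ = B.X , B.l , node refl B.buildNode B.buildLevels eA″ eF′
  where
  eA″ : Enc b′ _ 0 (a + p) A (const 0)
  eA″ = relevel (λ i → n≤0⇒n≡0 (Valid.bnd (valid eA′) i)) eA′
  -- That the marks still separate gaps in the rebuilt A follows from the agreement of statistics
  -- between the two readings of the subtree.
  module B = BuildNode (cond-transfer {A = A₀} (Node.cond nd) (Valid.inj (valid eA′)) (imp eA eA″ , imp eA″ eA)) (valid eA″) (valid eF′)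
    (unskip-end b b′ f₁ f₂ (Levels.q>0 lvs) (Levels.N≡ lvs)) (Levels.q>0 lvs)

-- Counting and largest letters

module _ {P : ℕ → Set} (P? : ∀ i → Dec (P i)) where

  count : ℕ → ℕ
  count zero = 0
  count (suc n) with P? n
  ... | yes _ = suc (count n)
  ... | no _  = count n

  count≤ : ∀ n → count n ≤ n
  count≤ zero = z≤n
  count≤ (suc n) with P? n
  ... | yes _ = s≤s (count≤ n)
  ... | no _  = m≤n⇒m≤1+n (count≤ n)

  count-suc : ∀ {n} → P n → count (suc n) ≡ suc (count n)
  count-suc {n} pn with P? n
  ... | yes _ = refl
  ... | no ¬p = ⊥-elim (¬p pn)

  count-step : ∀ n → count n ≤ count (suc n)
  count-step n with P? n
  ... | yes _ = n≤1+n _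
  ... | no _  = ≤-refl

  count-≤ : ∀ {m n} → m ≤ n → count m ≤ count n
  count-≤ {m} {zero} z≤n = ≤-refl
  count-≤ {m} {suc n} h with m≤n⇒m<n∨m≡n h
  ... | inj₁ lt   = ≤-trans (count-≤ (s≤s⁻¹ lt)) (count-step n)
  ... | inj₂ refl = ≤-refl

  count-< : ∀ {m n} → m < n → P m → count m < count n
  count-< m<n pm = ≤-trans (≤-reflexive (sym (count-suc pm))) (count-≤ m<n)

  count-onto : ∀ n {k} → k < count n → ∃ λ i → i < n × P i × count i ≡ k
  count-onto (suc n) {k} h with P? n
  ... | no _ = let (i , i<n , r) = count-onto n h in i , <-trans i<n (n<1+n n) , r
  ... | yes pn with m≤n⇒m<n∨m≡n (s≤s⁻¹ h)
  ...   | inj₁ lt = let (i , i<n , r) = count-onto n lt in i , <-trans i<n (n<1+n n) , r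
  ...   | inj₂ e  = n , n<1+n n , pn , sym e

  count-all : ∀ n → count n ≡ n → ∀ {i} → i < n → P i
  count-all (suc n) e {i} h with P? n
  ... | no _ = ⊥-elim (<-irrefl e (s≤s (count≤ n)))
  ... | yes pn with m≤n⇒m<n∨m≡n (s≤s⁻¹ h)
  ...   | inj₁ lt   = count-all n (suc-injective e) lt
  ...   | inj₂ refl = pn

  count-full : ∀ n → (∀ {i} → i < n → P i) → count n ≡ n
  count-full zero    _ = refl
  count-full (suc n) h = trans (count-suc (h (n<1+n n))) (cong suc (count-full n (λ i → h (<-trans i (n<1+n n)))))

module _ {P Q : ℕ → Set} (P? : ∀ i → Dec (P i)) (Q? : ∀ i → Dec (Q i)) where

  count-⊆ : ∀ n → (∀ {i} → i < n → P i → Q i) → count P? n ≤ count Q? n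
  count-⊆ zero    _ = z≤n
  count-⊆ (suc n) h with P? n | Q? n | count-⊆ n (λ i → h (<-trans i (n<1+n n)))
  ... | yes _ | yes _ | r = s≤s r
  ... | yes p | no ¬q | r = ⊥-elim (¬q (h (n<1+n n) p))
  ... | no _  | yes _ | r = m≤n⇒m≤1+n r
  ... | no _  | no _  | r = r

  count-⊂ : ∀ n → (∀ {i} → i < n → P i → Q i) → ∀ {i} → i < n → Q i → ¬ P i → count P? n < count Q? n
  count-⊂ (suc n) h {i} i<n q ¬p with m≤n⇒m<n∨m≡n (s≤s⁻¹ i<n)
  ... | inj₂ refl with P? n | Q? n | count-⊆ n (λ i → h (<-trans i (n<1+n n)))
  ...   | yes p | _     | _ = ⊥-elim (¬p p)
  ...   | no _  | yes _ | r = s≤s r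
  ...   | no _  | no ¬q | _ = ⊥-elim (¬q q)
  count-⊂ (suc n) h {i} i<n q ¬p | inj₁ lt with P? n | Q? n | count-⊂ n (λ i → h (<-trans i (n<1+n n))) lt q ¬p
  ... | yes _ | yes _ | r = s≤s r
  ... | yes p | no ¬q | r = ⊥-elim (¬q (h (n<1+n n) p))
  ... | no _  | yes _ | r = m≤n⇒m≤1+n r
  ... | no _  | no _  | r = r

argmax : ∀ n (X : Seq) → Inj (suc n) X → ∃ λ a → a < suc n × ∀ {k} → k < suc n → k ≢ a → X k < X a
argmax zero X inj = 0 , z<s , λ { (s≤s z≤n) ne → ⊥-elim (ne refl) }
argmax (suc n) X inj with argmax n X (λ i j → inj (<-trans i (n<1+n _)) (<-trans j (n<1+n _)))
... | a , a< , mx with <-cmp (X a) (X (suc n))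
...   | tri≈ _ e _ = <⇒≢′ a< (inj (<-trans a< (n<1+n _)) (n<1+n _) e)
...   | tri< t _ _ = suc n , n<1+n _ , go
  where
  go : ∀ {k} → k < suc (suc n) → k ≢ suc n → X k < X (suc n)
  go {k} h ne with k ≟ a
  ... | yes refl = t
  ... | no k≢a   = <-trans (mx (≤∧≢⇒< (s≤s⁻¹ h) ne) k≢a) t
...   | tri> _ _ t = a , <-trans a< (n<1+n _) , go
  where
  go : ∀ {k} → k < suc (suc n) → k ≢ a → X k < X a
  go {k} h ne with k ≟ suc n
  ... | yes refl = t
  ... | no k≢n   = mx (≤∧≢⇒< (s≤s⁻¹ h) k≢n) ne

argmax⁺ : ∀ {n} (X : Seq) → 0 < n → Inj n X → ∃ λ a → a < n × ∀ {k} → k < n → k ≢ a → X k < X a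
argmax⁺ {suc n} X _ = argmax n X

-- With at least one threshold level 0 is occupied, and a larger letter never has a larger level.
max-level0 : ∀ {b q n X l a} → Valid b q n X l → a < n → (∀ {k} → k < n → k ≢ a → X k < X a) → l a ≡ 0
max-level0 {q = q} {X = X} {l} {a} V a<n mx = 0<-or q (λ e → n≤0⇒n≡0 (subst (l a ≤_) e (bnd a<n))) go
  where
  open Valid V
  go : 0 < q → l a ≡ 0
  go o with occ o
  ... | j , j<n , e with j ≟ a
  ...   | yes refl = e
  ...   | no ne    = n≤0⇒n≡0 (≤-trans (anti j<n a<n (mx j<n ne)) (≤-reflexive e))

-- Parsing a levelled word into a tree

-- g sends the letters after position a to the gaps of α = X 0 … X (a - 1).
record GapSystem (a m p : ℕ) (X g : Seq) : Set where
  field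
    g≤         : ∀ j → g j ≤ suc p
    occ        : ∀ {k} → k < p → ∃ λ j → j < m × g j ≡ suc k
    above-some : ∀ {j} → j < m → g j ≤ p → ∃ λ i → i < a × X i < X (a + suc j)
    below-some : ∀ {j} → j < m → 0 < g j → ∃ λ i → i < a × X (a + suc j) < X i
    g-sep⁻     : ∀ {j j′} → j < m → j′ < m → g j < g j′ →
                 ∃ λ i → i < a × X (a + suc j′) < X i × X i < X (a + suc j)
    g-anti     : ∀ {j j′} → X (a + suc j) < X (a + suc j′) → g j′ ≤ g j

module Gaps {a m} {X : Seq} (a>0 : 0 < a) (inj : Inj (a + suc m) X)
  (mx : ∀ {k} → k < a + suc m → k ≢ a → X k < X a) where

  ρ : ℕ → ℕ
  ρ j = a + suc j

  α≢ρ : ∀ {i j} → i < a → j < m → X i ≢ X (ρ j)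
  α≢ρ i j e = <⇒≢′ (<-≤-trans i (m≤m+n a _)) (inj (left<end i) (right<end j) e)

  ≮⇒> : ∀ {i j} → i < a → j < m → ¬ X (ρ j) < X i → X i < X (ρ j)
  ≮⇒> i j h = ≤∧≢⇒< (≮⇒≥ h) (α≢ρ i j)

  higher : ∀ j i → Dec (X (ρ j) < X i)
  higher j i = X (ρ j) <? X i

  -- The raw gap, from 0 to `a`: the number of letters of α above the letter `j` of ρ.
  κ : ℕ → ℕ
  κ j = count (higher j) a

  κ-mono : ∀ {j j′} → X (ρ j) < X (ρ j′) → κ j′ ≤ κ j
  κ-mono {j} {j′} lt = count-⊆ (higher j′) (higher j) a (λ _ → <-trans lt)

  κ-sep : ∀ {i j j′} → i < a → X (ρ j′) < X i → X i < X (ρ j) → κ j < κ j′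
  κ-sep {j = j} {j′} i<a u v = count-⊂ (higher j) (higher j′) a (λ _ → <-trans (<-trans u v)) i<a u (<-asym v)

  κ-sep⁻ : ∀ {j j′} → j < m → j′ < m → κ j < κ j′ → ∃ λ i → i < a × X (ρ j′) < X i × X i < X (ρ j)
  κ-sep⁻ {j} {j′} j<m j′<m lt
    with anyUpTo? (λ i → (X (ρ j′) <? X i) ×-dec (X i <? X (ρ j))) a
  ... | yes r = r
  ... | no ne = ⊥-elim (<-irrefl refl (<-≤-trans lt (count-⊆ (higher j′) (higher j) a sub)))
    where
    sub : ∀ {i} → i < a → X (ρ j′) < X i → X (ρ j) < X i
    sub i<a u = ≤∧≢⇒< (≮⇒≥ (λ v → ne (_ , i<a , u , v))) (≢-sym (α≢ρ i<a j<m))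

  -- Occupied c says that a letter of ρ has exactly suc c letters of α above it.
  Occupied : ℕ → Set
  Occupied c = ∃ λ j → j < m × κ j ≡ suc c

  occupied? : ∀ c → Dec (Occupied c)
  occupied? c = anyUpTo? (λ j → κ j ≟ suc c) m

  g : ℕ → ℕ
  g j = count occupied? (κ j)

  -- Only interior gaps are counted: the bound `a ∸ 1` excludes the lowest gap, and the shift in
  -- `Occupied` the highest.
  p : ℕ
  p = count occupied? (a ∸ 1)

  g-≤ : ∀ {j j′} → κ j ≤ κ j′ → g j ≤ g j′
  g-≤ = count-≤ occupied?

  g-< : ∀ {j j′} → j′ < m → κ j < κ j′ → g j < g j′
  g-< {j} {j′} j′<m lt with κ j′ in e
  ... | suc c = ≤-trans (s≤s (count-≤ occupied? (s≤s⁻¹ lt))) (≤-reflexive (sym (count-suc occupied? (j′ , j′<m , e))))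

  g-sep⁻ : ∀ {j j′} → j < m → j′ < m → g j < g j′ → ∃ λ i → i < a × X (ρ j′) < X i × X i < X (ρ j)
  g-sep⁻ {j} {j′} j<m j′<m lt = κ-sep⁻ j<m j′<m (≰⇒> (λ h → <-irrefl refl (<-≤-trans lt (g-≤ {j′} {j} h))))

  g-sep : ∀ {i j j′} → i < a → j′ < m → X (ρ j′) < X i → X i < X (ρ j) → g j < g j′
  g-sep {j = j} {j′} i<a j′<m u v = g-< {j} {j′} j′<m (κ-sep i<a u v)

  g-anti : ∀ {j j′} → X (ρ j) < X (ρ j′) → g j′ ≤ g j
  g-anti {j} {j′} lt = g-≤ {j′} {j} (κ-mono lt)

  g≤ : ∀ j → g j ≤ suc p
  g≤ j = ≤-trans (count-≤ occupied? (count≤ (higher j) a)) (end a)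
    where
    end : ∀ a → count occupied? a ≤ suc (count occupied? (a ∸ 1))
    end zero    = z≤n
    end (suc c) with occupied? c
    ... | yes _ = ≤-refl
    ... | no _  = n≤1+n _

  above-some : ∀ {j} → j < m → g j ≤ p → ∃ λ i → i < a × X i < X (ρ j)
  above-some {j} j<m gj≤p with anyUpTo? (λ i → X i <? X (ρ j)) a
  ... | yes r = r
  ... | no ne = ⊥-elim (<-irrefl refl (<-≤-trans p<g gj≤p))
    where
    κ≡a : κ j ≡ a
    κ≡a = count-full (higher j) a (λ i<a → ≤∧≢⇒< (≮⇒≥ (λ u → ne (_ , i<a , u))) (≢-sym (α≢ρ i<a j<m)))
    a≡ : suc (a ∸ 1) ≡ a
    a≡ = m+[n∸m]≡n a>0
    p<g : p < g j
    p<g = subst (λ x → p < count occupied? x) (sym κ≡a)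
      (count-< occupied? (≤-reflexive a≡) (j , j<m , trans κ≡a (sym a≡)))

  g≤p : ∀ {i j} → i < a → X i < X (ρ j) → g j ≤ p
  g≤p {i} {j} i<a lt = count-≤ occupied? (∸-monoˡ-≤ 1 κ<a)
    where
    κ<a : κ j < a
    κ<a = ≤∧≢⇒< (count≤ (higher j) a) (λ e → asym lt (count-all (higher j) a e i<a))

  below-some : ∀ {j} → j < m → 0 < g j → ∃ λ i → i < a × X (ρ j) < X i
  below-some {j} j<m 0<g with anyUpTo? (λ i → X (ρ j) <? X i) a
  ... | yes r = r
  ... | no ne = ⊥-elim (<-irrefl refl (<-≤-trans 0<g (≤-reflexive (cong (count occupied?) κ≡0))))
    where
    κ≡0 : κ j ≡ 0
    κ≡0 = n≤0⇒n≡0 (≮⇒≥ λ o → let (i , i<a , u , _) = count-onto (higher j) a o in ne (i , i<a , u))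

  0<g : ∀ {i j} → i < a → j < m → X (ρ j) < X i → 0 < g j
  0<g {i} {j} i<a j<m lt with κ j in e
  ... | suc c = ≤-trans (s≤s z≤n) (≤-reflexive (sym (count-suc occupied? (j , j<m , e))))
  ... | zero  = ⊥-elim (<-irrefl (sym e) (≤-<-trans z≤n (count-⊂ {P = λ _ → ⊥} (λ _ → no (λ ())) (higher j) a (λ _ ()) i<a lt (λ ()))))

  sameGap : ∀ {i j j′} → i < a → j < m → g j ≡ g j′ → X (ρ j) < X i → X i < X (ρ j′) → ⊥
  sameGap i<a j<m e u v = <⇒≢′ (g-sep i<a j<m u v) (sym e)

  occ : ∀ {k} → k < p → ∃ λ j → j < m × g j ≡ suc k
  occ h with count-onto occupied? (a ∸ 1) h
  ... | c , _ , o@(j , j<m , e) , ck = j , j<m , trans (cong (count occupied?) e) (trans (count-suc occupied? o) (cong suc ck))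

  gapSystem : GapSystem a m p X g
  gapSystem = record { g≤ = g≤ ; occ = occ ; above-some = above-some ; below-some = below-some
                     ; g-sep⁻ = g-sep⁻ ; g-anti = λ {j} {j′} → g-anti {j} {j′} }

  -- Any letter of the gap can serve as its mark, since letters of one gap compare alike with all of
  -- α.
  rep : ℕ → ℕ
  rep k with k <? p
  ... | yes h = proj₁ (occ h)
  ... | no _  = 0

  rep< : ∀ {k} → k < p → rep k < m
  rep< {k} h with k <? p
  ... | yes h = proj₁ (proj₂ (occ h))
  ... | no ¬h = ⊥-elim (¬h h)

  g-rep : ∀ {k} → k < p → g (rep k) ≡ suc k
  g-rep {k} h with k <? p
  ... | yes h = proj₂ (proj₂ (occ h))
  ... | no ¬h = ⊥-elim (¬h h)

  -- Distinct gaps have distinct representatives. This makes A shorter than X, as the recursion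
  -- requires.
  p≤m : p ≤ m
  p≤m = injective⇒≤ {f = λ k → fromℕ< (rep< (toℕ<n k))} λ {k} {k′} e → toℕ-injective (suc-injective
    (trans (sym (g-rep (toℕ<n k))) (trans (cong g (fromℕ<-injective _ _ (rep< (toℕ<n k)) (rep< (toℕ<n k′)) e)) (g-rep (toℕ<n k′)))))

  ι : ℕ → ℕ
  ι i with i <? a
  ... | yes _ = i
  ... | no _  = ρ (rep (i ∸ a))

  ι-left : ∀ {i} → i < a → ι i ≡ i
  ι-left {i} h with i <? a
  ... | yes _ = refl
  ... | no ¬h = ⊥-elim (¬h h)

  ι-right : ∀ k → ι (a + k) ≡ ρ (rep k)
  ι-right k with a + k <? a
  ... | yes h = ⊥-elim (<-irrefl refl (≤-<-trans (m≤m+n a k) h))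
  ... | no _  = cong (ρ ∘ rep) (m+n∸m≡n a k)

  A : Seq
  A = X ∘ ι

  private
    α= : ∀ {i} → i < a → A i ≡ X i
    α= h = cong X (ι-left h)
    e= : ∀ k → A (a + k) ≡ X (ρ (rep k))
    e= k = cong X (ι-right k)

  cond : Cond a p A
  cond = record { high = high ; sep = sep ; lowest = lowest }
    where
    high : ∃ λ i → i < a × RL (a + p) A i
    high with argmax⁺ X a>0 (λ i j → inj (left<end i) (left<end j))
    ... | i , i<a , mx = i , i<a , λ {k} i<k k< → subst (A k <_) (sym (α= i<a)) (go (pos₂ a p k<) i<k)
      where
      below-top : ∀ {j} → j < a → X j ≤ X i
      below-top {j} j<a with j ≟ i
      ... | yes refl = ≤-refl
      ... | no ne    = <⇒≤ (mx j<a ne)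
      go : ∀ {k} → Pos₂ a p k → i < k → A k < X i
      go (left u) i<k = subst (_< X i) (sym (α= u)) (mx u (>⇒≢ i<k))
      go (right {k} u) _ with below-some (rep< u) (subst (0 <_) (sym (g-rep u)) z<s)
      ... | i′ , i′<a , v = subst (_< X i) (sym (e= k)) (<-≤-trans v (below-top i′<a))
    sep : ∀ {k} → suc k < p → ∃ λ i → i < a × A (a + suc k) < A i × A i < A (a + k)
    sep {k} h = let (i , i<a , u , v) = g-sep⁻ (rep< k<p) (rep< h) (subst₂ _<_ (sym (g-rep k<p)) (sym (g-rep h)) (n<1+n _)) in
      i , i<a , subst₂ _<_ (sym (e= (suc k))) (sym (α= i<a)) u , subst₂ _<_ (sym (α= i<a)) (sym (e= k)) v
      where
      k<p = <-trans (n<1+n k) h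
    lowest : ∀ {k} → suc k ≡ p → ∃ λ i → i < a × A i < A (a + k)
    lowest {k} e = let k<p = ≤-reflexive e
                       (i , i<a , u) = above-some (rep< k<p) (≤-trans (≤-reflexive (g-rep k<p)) k<p) in
      i , i<a , subst₂ _<_ (sym (α= i<a)) (sym (e= k)) u

  maxα : ∀ {i} → i < a → X i < X a
  maxα i = mx (left<end i) (<⇒≢ i)

  maxρ : ∀ {j} → j < m → X (ρ j) < X a
  maxρ j = mx (right<end j) (>⇒≢ (m<m+n a z<s))

  node-of : Node a m p X A (X ∘ ρ) g
  node-of = record
    { cond  = cond
    ; inα   = λ i j → subst₂ _<_ (α= i) (α= j)
    ; maxα  = maxα
    ; maxρ  = maxρ
    ; inρ   = λ _ _ lt → lt
    ; g≤    = λ {j} _ → g≤ j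
    ; occ   = occ
    ; above = λ i j e → ≮⇒> i j (λ lt → <⇒≢′ (0<g i j lt) (sym e))
    ; up    = λ {_} {_} {k} i j k<p e lt → ≮⇒> i j (λ lt′ →
                sameGap i j (trans e (sym (g-rep k<p))) lt′ (subst₂ _<_ (α= i) (e= k) lt))
    ; down  = λ {_} {_} {k} i j k<p e lt → ≤∧≢⇒< (≮⇒≥ (λ lt′ →
                sameGap i (rep< k<p) (trans (g-rep k<p) (sym e)) (subst₂ _<_ (e= k) (α= i) lt) lt′)) (≢-sym (α≢ρ i j))
    ; below = λ i j e → ≤∧≢⇒< (≮⇒≥ (λ lt → <-irrefl refl (<-≤-trans (≤-reflexive (sym e)) (g≤p i lt)))) (≢-sym (α≢ρ i j))
    }

  -- Above the lowest gap, an ascent across gaps in ρ would complete an occurrence with a letter of α and the maximum.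
  gaps-ordered : ∀ {b} → Av b (a + suc m) X → ∀ {j j′} → j < j′ → j′ < m → g j ≤ p → g j′ < g j → ⊥
  gaps-ordered {true} av {j} {j′} j<j′ j′<m gj lt =
    let j<m = <-trans j<j′ j′<m
        (i , i<a , u) = above-some j<m gj
        (_ , _ , v , w) = g-sep⁻ j′<m j<m lt
    in av i<a (m<m+n a z<s) (+-monoʳ-< a (s<s j<j′)) (right<end j′<m) (u , <-trans v w , maxρ j′<m)
  gaps-ordered {false} av {j} {j′} j<j′ j′<m gj lt =
    let j<m = <-trans j<j′ j′<m
        (i , i<a , v , w) = g-sep⁻ j′<m j<m lt
    in av i<a (m<m+n a z<s) (+-monoʳ-< a (s<s j<j′)) (right<end j′<m) (v , w , maxρ j′<m)

  ι< : ∀ {i} → i < a + p → ι i < a + suc m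
  ι< {i} h = go (pos₂ a p h)
    where
    go : ∀ {i} → Pos₂ a p i → ι i < a + suc m
    go (left u)      = subst (_< _) (sym (ι-left u)) (left<end u)
    go (right {k} u) = subst (_< _) (sym (ι-right k)) (right<end (rep< u))

  -- By `gaps-ordered` representatives of lower gaps come later in ρ, so A is a subsequence of X and
  -- inherits the avoidance.
  ι-incr : ∀ {b} → Av b (a + suc m) X → ∀ {i j} → i < j → j < a + p → ι i < ι j
  ι-incr av i<j j< = go (pos₂ a p (<-trans i<j j<)) (pos₂ a p j<) i<j
    where
    go : ∀ {i j} → Pos₂ a p i → Pos₂ a p j → i < j → ι i < ι j
    go (left u) (left v) lt = subst₂ _<_ (sym (ι-left u)) (sym (ι-left v)) lt
    go (left u) (right {k} v) _ = subst₂ _<_ (sym (ι-left u)) (sym (ι-right k)) (<-≤-trans u (m≤m+n a _))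
    go (right u) (left v) lt = right≮left v lt
    go (right {k} u) (right {k′} v) lt = subst₂ _<_ (sym (ι-right k)) (sym (ι-right k′)) (+-monoʳ-< a (s<s reps))
      where
      k<k′ = +-cancelˡ-< a _ _ lt
      reps : rep k < rep k′
      reps with <-cmp (rep k) (rep k′)
      ... | tri< h _ _ = h
      ... | tri≈ _ e _ = <⇒≢′ (s<s k<k′) (trans (sym (g-rep u)) (trans (cong g e) (g-rep v)))
      ... | tri> _ _ h = ⊥-elim (gaps-ordered av h (rep< u) (≤-trans (≤-reflexive (g-rep v)) v)
                           (subst₂ _<_ (sym (g-rep u)) (sym (g-rep v)) (s<s k<k′)))

  validA : ∀ {b} → Av b (a + suc m) X → Valid b 0 (a + p) A (const 0)
  validA {b} av = record
    { inj  = λ i j e → ι-inj i j (inj (ι< i) (ι< j) e)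
    ; av   = λ i<j j<k k<l l< → let k< = <-trans k<l l<; j< = <-trans j<k k< in
               av (ι-incr av i<j j<) (ι-incr av j<k k<) (ι-incr av k<l l<) (ι< l<)
    ; bnd  = λ _ → z≤n
    ; occ  = λ ()
    ; anti = λ _ _ _ → z≤n
    ; lv   = lv b
    }
    where
    ι-inj : ∀ {i j} → i < a + p → j < a + p → ι i ≡ ι j → i ≡ j
    ι-inj {i} {j} i< j< e with <-cmp i j
    ... | tri< h _ _ = <⇒≢′ (ι-incr av h j<) e
    ... | tri≈ _ h _ = h
    ... | tri> _ _ h = <⇒≢′ (ι-incr av h i<) (sym e)
    lv : ∀ b → LvCond b 0 (a + p) A (const 0)
    lv true  _ _ ()
    lv false _ _ = z≤n

module ParseLevels {b q a m p} {X l g : Seq} (V : Valid b q (a + suc m) X l)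
  (mx : ∀ {k} → k < a + suc m → k ≢ a → X k < X a) (gs : GapSystem a m p X g) where

  private module V = Valid V
  open GapSystem gs

  ρ : ℕ → ℕ
  ρ j = a + suc j

  maxα : ∀ {i} → i < a → X i < X a
  maxα i = mx (left<end i) (<⇒≢ i)

  maxρ : ∀ {j} → j < m → X (ρ j) < X a
  maxρ j = mx (right<end j) (>⇒≢ (m<m+n a z<s))

  onMax : l a ≡ 0
  onMax = max-level0 V peak<end mx

  onα : ∀ {i} → i < a → l i ≡ αlevel b q
  onα = go b V.lv
    where
    go : ∀ b → LvCond b q (a + suc m) X l → ∀ {i} → i < a → l i ≡ αlevel b q
    go true lv {i} i<a with m≤n⇒m<n∨m≡n (V.bnd (left<end i<a))
    ... | inj₂ e  = e
    ... | inj₁ lt = asym (maxα i<a) (lv i<a peak<end lt (subst (_< q) (sym onMax) (≤-<-trans z≤n lt)))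
    go false lv i<a = n≤0⇒n≡0 (≤-trans (lv i<a peak<end) (≤-reflexive onMax))

  l≤ : ∀ {j} → j < m → l (ρ j) ≤ q
  l≤ j = V.bnd (right<end j)

  mode : ∀ {j} → j < m → Mode b q p (g j) (l (ρ j))
  mode = go b onα
    where
    go : ∀ b → (∀ {i} → i < a → l i ≡ αlevel b q) → ∀ {j} → j < m → Mode b q p (g j) (l (ρ j))
    go true onα j<m o with below-some j<m o
    ... | i , i<a , u = ≤-antisym (l≤ j<m) (subst (_≤ _) (onα i<a) (V.anti (right<end j<m) (left<end i<a) u))
    go false onα {j} j<m o with m≤n⇒m<n∨m≡n (g≤ j)
    ... | inj₂ e = e
    ... | inj₁ lt = let (i , i<a , u) = above-some j<m (s≤s⁻¹ lt) in
      ⊥-elim (<-irrefl refl (<-≤-trans o (≤-trans (V.anti (left<end i<a) (right<end j<m) u) (≤-reflexive (onα i<a)))))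

  h : ℕ → ℕ
  h j = g j + l (ρ j)

  s : ℕ
  s = skipped b q p

  HasIndex : ℕ → Set
  HasIndex x = ∃ λ j → j < m × h j ≡ x

  hasIndex? : ∀ x → Dec (HasIndex x)
  hasIndex? x = anyUpTo? (λ j → h j ≟ x) m

  flag₁ : Σ Bool λ f → (f ≡ true → HasIndex 0) × (f ≡ false → ¬ HasIndex 0)
  flag₁ with hasIndex? 0
  ... | yes r = true , (λ _ → r) , λ ()
  ... | no ¬r = false , (λ ()) , λ _ → ¬r

  -- For `q = 0` the corner is the start or the end of the chain, and the flag is true by
  -- convention; this keeps the tree unique.
  flag₂ : Σ Bool λ f → (f ≡ true → 0 < q → HasIndex s) × (f ≡ false → 0 < q × ¬ HasIndex s)
  flag₂ with 0 <? q | hasIndex? s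
  ... | yes _ | yes r = true , (λ _ _ → r) , λ ()
  ... | yes o | no ¬r = false , (λ ()) , λ _ → o , ¬r
  ... | no ¬o | _     = true , (λ _ o → ⊥-elim (¬o o)) , λ ()

  f₁ f₂ : Bool
  f₁ = proj₁ flag₁
  f₂ = proj₁ flag₂

  q>0 : f₂ ≡ false → 0 < q
  q>0 e = proj₁ (proj₂ (proj₂ flag₂) e)

  U : ℕ → ℕ
  U = unskip f₁ f₂ s

  U↑ : Increasing U
  U↑ = unskip-incr f₁ f₂ s

  end : ∃ λ N → U N ≡ q + suc p
  end = unskip-onto f₁ f₂ s (q + suc p) (s>0 b q>0) (λ _ e → <⇒≢′ (subst (0 <_) (sym (+-suc q p)) z<s) (sym e))
          (λ e e′ → <⇒≢′ (skipped< b p (q>0 e)) (sym e′))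

  N : ℕ
  N = proj₁ end

  index : ∀ {j} → j < m → ∃ λ c → U c ≡ h j
  index {j} j<m = unskip-onto f₁ f₂ s (h j) (s>0 b q>0) (λ e z → proj₂ (proj₂ flag₁) e (j , j<m , z))
                    (λ e z → proj₂ (proj₂ (proj₂ flag₂) e) (j , j<m , z))

  lF : ℕ → ℕ
  lF j with j <? m
  ... | yes j<m = proj₁ (index j<m)
  ... | no _    = 0

  U-lF : ∀ {j} → j < m → U (lF j) ≡ h j
  U-lF {j} j<m with j <? m
  ... | yes j<m = proj₂ (index j<m)
  ... | no ¬j   = ⊥-elim (¬j j<m)

  levels-of : Levels b q a m p N f₁ f₂ l g lF
  levels-of = record
    { onα = onα ; onMax = onMax ; sum = λ j → sym (U-lF j) ; l≤ = l≤ ; mode = mode ; N≡ = proj₂ end ; q>0 = q>0 }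

module ParseTail {b q a m p N f₁ f₂} {X l g lF : Seq} (V : Valid b q (a + suc m) X l)
  (mx : ∀ {k} → k < a + suc m → k ≢ a → X k < X a) (gs : GapSystem a m p X g)
  (lvs : Levels b q a m p N f₁ f₂ l g lF) where

  private
    module V = Valid V
  open ParseLevels V mx gs using (ρ; maxα; maxρ; HasIndex)
  open GapSystem gs
  open Levels lvs

  s : ℕ
  s = skipped b q p

  U : ℕ → ℕ
  U = unskip f₁ f₂ s

  U↑ : Increasing U
  U↑ = unskip-incr f₁ f₂ s

  U-lF : ∀ {j} → j < m → U (lF j) ≡ g j + l (ρ j)
  U-lF j<m = sym (sum j<m)

  module _ (has-0 : f₁ ≡ true → HasIndex 0) (has-s : f₂ ≡ true → 0 < q → HasIndex (skipped b q p)) where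

    levelled : ∀ {c} → 0 < c → c < q → (∀ {i} → i < a → l i ≢ c) → ∃ λ j → j < m × l (ρ j) ≡ c
    levelled {c} 0<c c<q notα with V.occ c<q
    ... | j , j<n , e = go (pos a m j<n) e
      where
      go : ∀ {j} → Pos a m j → l j ≡ c → ∃ λ j → j < m × l (ρ j) ≡ c
      go (left u)  e = ⊥-elim (notα u e)
      go peak      e = <⇒≢′ 0<c (trans (sym onMax) e)
      go (right u) e = _ , u , e

    -- An index below the end, other than 0 and the corner, stands for an interior gap, which ρ
    -- meets, or for a level strictly between 0 and `q`, which neither α nor the maximum has.
    h-onto : ∀ {x} → x < q + suc p → (f₁ ≡ false → x ≢ 0) → (f₂ ≡ false → x ≢ s) → HasIndex x
    h-onto {zero}    _  ne₁ _   = has-0 (¬-not λ e → ne₁ e refl)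
    h-onto {x@(suc _)} x< _ ne₂ = go b onα mode z<s x< λ e →
      subst HasIndex (sym e) (has-s (¬-not (λ e′ → ne₂ e′ e)) (positive b e x<))
      where
      positive : ∀ b {x} → suc x ≡ skipped b q p → suc x < q + suc p → 0 < q
      positive true  refl _  = z<s
      positive false refl x< = +-cancelʳ-< (suc p) 0 q x<
      go : ∀ b → (∀ {i} → i < a → l i ≡ αlevel b q) → (∀ {j} → j < m → Mode b q p (g j) (l (ρ j))) →
           ∀ {x} → 0 < x → x < q + suc p → (x ≡ skipped b q p → HasIndex x) → HasIndex x
      go true onα mode {x} 0<x x< at-s with <-cmp x q
      ... | tri≈ _ e _ = at-s e
      ... | tri< x<q _ _ with levelled 0<x x<q (λ i e → <⇒≢′ x<q (trans (sym e) (onα i)))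
      ...   | j , j<m , e = j , j<m , 0<-or (g j) (λ g0 → cong₂ _+_ g0 e) (λ o → <⇒≢′ x<q (trans (sym e) (mode j<m o)))
      go true onα mode {x} 0<x x< at-s | tri> _ _ q<x with m≤n⇒∃[o]m+o≡n q<x
      ... | k , refl with occ (s<s⁻¹ (+-cancelˡ-< q _ _ (subst (_< q + suc p) (sym (+-suc q k)) x<)))
      ...   | j , j<m , e = j , j<m , trans (cong₂ _+_ e (mode j<m (subst (0 <_) (sym e) z<s))) (cong suc (+-comm k q))
      go false onα mode {suc x} 0<x x< at-s with <-cmp (suc x) (suc p)
      ... | tri≈ _ e _ = at-s e
      ... | tri< (s<s x<p) _ _ with occ x<p
      ...   | j , j<m , e = j , j<m ,
        0<-or (l (ρ j)) (λ l0 → trans (cong₂ _+_ e l0) (+-identityʳ (suc x)))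
          (λ o → <⇒≢′ (s<s x<p) (trans (sym e) (mode j<m o)))
      go false onα mode {suc x} 0<x x< at-s | tri> _ _ p<x with m≤n⇒∃[o]m+o≡n p<x
      ...   | c , refl with levelled {suc c} z<s (+-cancelʳ-< (suc p) _ _ (subst (_< q + suc p) (cong suc (+-comm (suc p) c)) x<))
                              (λ i e → <⇒≢′ z<s (trans (sym (onα i)) e))
      ...     | j , j<m , e = j , j<m , trans (cong₂ _+_ (mode j<m (subst (0 <_) (sym e) z<s)) e) (+-suc (suc p) c)

    validF : Valid b N m (X ∘ ρ) lF
    validF = record
      { inj  = λ i j e → suc-injective (+-cancelˡ-≡ a _ _ (V.inj (right<end i) (right<end j) e))
      ; av   = λ i<j j<k k<l l<m → V.av (shift i<j) (shift j<k) (shift k<l) (right<end l<m)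
      ; bnd  = λ j → incr-≤ U↑ (subst₂ _≤_ (sym (U-lF j)) (trans (+-comm (suc p) q) (sym N≡)) (+-mono-≤ (g≤ _) (l≤ j)))
      ; occ  = occF
      ; anti = λ {i} {j} i<m j<m lt → lF≤ j<m i<m (g-anti {i} {j} lt) (V.anti (right<end i<m) (right<end j<m) lt)
      ; lv   = lvF b V.av mode V.lv
      }
      where
      shift : ∀ {i j} → i < j → ρ i < ρ j
      shift lt = +-monoʳ-< a (s<s lt)
      lF≤ : ∀ {i j} → i < m → j < m → g i ≤ g j → l (ρ i) ≤ l (ρ j) → lF i ≤ lF j
      lF≤ i j u v = incr-≤ U↑ (subst₂ _≤_ (sym (U-lF i)) (sym (U-lF j)) (+-mono-≤ u v))
      occF : ∀ {c} → c < N → ∃ λ j → j < m × lF j ≡ c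
      occF {c} c<N with h-onto (subst (U c <_) N≡ (U↑ c<N)) (λ e → unskip-avoids-0 f₁ f₂ s e (s>0 b q>0) c)
                          (λ e → unskip-avoids-s f₁ f₂ s e c)
      ... | j , j<m , e = j , j<m , incr-inj U↑ (trans (U-lF j<m) e)
      lvF : ∀ b → Av b (a + suc m) X → (∀ {j} → j < m → Mode b q p (g j) (l (ρ j))) →
            LvCond b q (a + suc m) X l → LvCond b N m (X ∘ ρ) lF
      -- Before the end of the chain a letter of ρ has some letter of α below it, so an ascent would
      -- complete 1423 with that letter and the maximum.
      lvF true av mode lv {i} {j} i<j j<m li lj with <-cmp (X (ρ i)) (X (ρ j))
      ... | tri> _ _ lt = lt
      ... | tri≈ _ e _  = <⇒≢′ (shift i<j) (V.inj (right<end (<-trans i<j j<m)) (right<end j<m) e)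
      ... | tri< lt _ _ = let (k , k<a , u) = above-some i<m gi in
            ⊥-elim (av k<a (m<m+n a z<s) (shift i<j) (right<end j<m) (u , lt , maxρ j<m))
        where
        i<m = <-trans i<j j<m
        gi : g i ≤ p
        gi with m≤n⇒m<n∨m≡n (g≤ i)
        ... | inj₁ h = s≤s⁻¹ h
        ... | inj₂ e = <⇒≢′ (U↑ li) (trans (U-lF i<m) (trans (cong₂ _+_ e (mode i<m (subst (0 <_) (sym e) z<s)))
                         (trans (+-comm (suc p) q) (sym N≡))))
      -- A later letter in a higher gap would complete 2413 with a letter of α in between and the
      -- maximum.
      lvF false av mode lv {i} {j} i<j j<m = lF≤ i<m j<m
        (≮⇒≥ λ lt → let (k , k<a , u , v) = g-sep⁻ j<m i<m lt in
          av k<a (m<m+n a z<s) (shift i<j) (right<end j<m) (u , v , maxρ j<m))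
        (lv (shift i<j) (right<end j<m))
        where
        i<m = <-trans i<j j<m

module ParseFirst {b q m} {X l : Seq} (V : Valid b q (suc m) X l) where

  private module V = Valid V

  validF : ∀ f {N} {lF : Seq} → q ≡ skip f 0 N → (∀ {j} → j < m → l (suc j) ≡ skip f 0 (lF j)) →
           (∀ {c} → c < N → ∃ λ j → j < m × lF j ≡ c) → Valid b N m (X ∘ suc) lF
  validF f {N} {lF} q≡ ls occ = record
    { inj  = λ i j e → suc-injective (V.inj (s<s i) (s<s j) e)
    ; av   = λ u v w r → V.av (s<s u) (s<s v) (s<s w) (s<s r)
    ; bnd  = λ j → incr-≤ V↑ (subst₂ _≤_ (ls j) q≡ (V.bnd (s<s j)))
    ; occ  = occ
    ; anti = λ i j lt → incr-≤ V↑ (subst₂ _≤_ (ls j) (ls i) (V.anti (s<s i) (s<s j) lt))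
    ; lv   = lvF b V.lv
    }
    where
    V↑ = skip-incr f 0
    lvF : ∀ b → LvCond b q (suc m) X l → LvCond b N m (X ∘ suc) lF
    lvF true lv i<j j<m li lj = lv (s<s i<j) (s<s j<m) (below (<-trans i<j j<m) li) (below j<m lj)
      where
      below : ∀ {j} → j < m → lF j < N → l (suc j) < q
      below j h = subst₂ _<_ (sym (ls j)) (sym q≡) (skip-incr f 0 h)
    lvF false lv i<j j<m = incr-≤ V↑ (subst₂ _≤_ (ls (<-trans i<j j<m)) (ls j<m) (lv (s<s i<j) (s<s j<m)))

  occ-suc : l 0 ≡ 0 → ∀ {c} → suc c < q → ∃ λ j → j < m × l (suc j) ≡ suc c
  occ-suc l0 c<q with V.occ c<q
  ... | zero  , _ , e with () ← trans (sym l0) e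
  ... | suc j , j< , e = j , s<s⁻¹ j< , e

Parsed : Bool → (q n : ℕ) (X l : Seq) → Set
Parsed b q n X l = ∃ λ t → Enc b t q n X l

Rec : Bool → ℕ → Set
Rec b n = ∀ {k} → k < n → ∀ {q X l} → Valid b q k X l → Parsed b q k X l

parse-node : ∀ {b q X l a m} → 0 < a → Valid b q (a + suc m) X l → (∀ {k} → k < a + suc m → k ≢ a → X k < X a) →
             Rec b (a + suc m) → Parsed b q (a + suc m) X l
parse-node {a = a} {m} a>0 V mx rec =
  let (tA , eA) = rec (+-monoʳ-< a (s≤s G.p≤m)) (G.validA (Valid.av V))
      (tF , eF) = rec (<-≤-trans (n<1+n m) (m≤n+m (suc m) a))
                    (ParseTail.validF V mx G.gapSystem L.levels-of (proj₁ (proj₂ L.flag₁)) (proj₁ (proj₂ L.flag₂)))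
  in node a m G.p L.N L.f₁ L.f₂ tA tF , node refl G.node-of L.levels-of eA eF
  where
  module G = Gaps a>0 (Valid.inj V) mx
  module L = ParseLevels V mx G.gapSystem

parse-first : ∀ {b q n X l} → Valid b q (suc n) X l → (∀ {k} → k < suc n → k ≢ 0 → X k < X 0) →
              Rec b (suc n) → Parsed b q (suc n) X l
parse-first {b} {q} {n} {X} {l} V mx rec = go q refl (anyUpTo? (λ j → l (suc j) ≟ 0) n)
  where
  open ParseFirst V
  l0 : l 0 ≡ 0
  l0 = max-level0 V z<s mx
  by : ∀ f {N} {lF : Seq} → q ≡ skip f 0 N → (∀ {j} → j < n → l (suc j) ≡ skip f 0 (lF j)) →
       (∀ {c} → c < N → ∃ λ j → j < n × lF j ≡ c) → Parsed b q (suc n) X l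
  by f q≡ ls occ = let (t , e) = rec (n<1+n n) (validF f q≡ ls occ) in
    first f n _ t , first refl q≡ l0 (λ j → mx (s<s j) (λ ())) ls e
  go : ∀ q′ → q ≡ q′ → Dec (∃ λ j → j < n × l (suc j) ≡ 0) → Parsed b q (suc n) X l
  go zero     q≡ _       = by true {lF = l ∘ suc} q≡ (λ _ → refl) (λ ())
  go (suc q′) q≡ (yes r) = by true {N = q} {l ∘ suc} refl (λ _ → refl) λ { {zero} _ → r ; {suc c} h → occ-suc l0 h }
  go (suc q′) q≡ (no ¬r) = by false {lF = λ j → l (suc j) ∸ 1} q≡ ls λ {c} h →
    let (j , j<n , e) = occ-suc l0 (subst (suc c <_) (sym q≡) (s<s h)) in j , j<n , cong (_∸ 1) e
    where
    ls : ∀ {j} → j < n → l (suc j) ≡ suc (l (suc j) ∸ 1)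
    ls {j} j<n = 0<-or (l (suc j)) (λ e → ⊥-elim (¬r (j , j<n , e))) (λ o → sym (m+[n∸m]≡n o))

parse-step : ∀ {b} n → Rec b n → ∀ {q X l} → Valid b q n X l → Parsed b q n X l
parse-step zero rec {zero}  V = nil , nil
parse-step zero rec {suc q} V with Valid.occ V z<s
... | _ , () , _
parse-step {b} (suc n) rec {q} {X} {l} V = go (argmax n X (Valid.inj V))
  where
  at-peak : ∀ {a m n} → a + suc m ≡ n → 0 < a → Rec b n → Valid b q n X l →
            (∀ {k} → k < n → k ≢ a → X k < X a) → Parsed b q n X l
  at-peak refl a>0 rec V mx = parse-node a>0 V mx rec
  go : (∃ λ a → a < suc n × ∀ {k} → k < suc n → k ≢ a → X k < X a) → Parsed b q (suc n) X l
  go (zero  , _  , mx) = parse-first V mx rec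
  go (suc a , a< , mx) = let (m , e) = m≤n⇒∃[o]m+o≡n (s≤s⁻¹ a<) in
    at-peak (trans (+-suc (suc a) m) (cong suc e)) z<s rec V mx

parse : ∀ {b n q X l} → Valid b q n X l → Parsed b q n X l
parse {b} {n} = <-rec (λ n → ∀ {q X l} → Valid b q n X l → Parsed b q n X l) parse-step n

-- Words over `Fin n` as sequences, and standardization

module _ {n : ℕ} where

  seq : Word n → Seq
  seq π i with i <? n
  ... | yes i<n = toℕ (lookup π (fromℕ< i<n))
  ... | no _    = 0

  seq-toℕ : ∀ π i → seq π (toℕ i) ≡ toℕ (lookup π i)
  seq-toℕ π i with toℕ i <? n
  ... | yes h = cong (toℕ ∘ lookup π) (fromℕ<-toℕ i h)
  ... | no ¬h = ⊥-elim (¬h (toℕ<n i))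

  onFin : ∀ {P : ℕ → Set} → (∀ (i : Fin n) → P (toℕ i)) → ∀ {i} → i < n → P i
  onFin {P} h i<n = subst P (toℕ-fromℕ< i<n) (h (fromℕ< i<n))

  seq-< : ∀ π i j → lookup π i Fin.< lookup π j → seq π (toℕ i) < seq π (toℕ j)
  seq-< π i j = subst₂ _<_ (sym (seq-toℕ π i)) (sym (seq-toℕ π j))

  seq-<⁻ : ∀ π i j → seq π (toℕ i) < seq π (toℕ j) → lookup π i Fin.< lookup π j
  seq-<⁻ π i j = subst₂ _<_ (seq-toℕ π i) (seq-toℕ π j)

  rank : Seq → ℕ → ℕ
  rank X i = count (λ k → X k <? X i) n

  rank< : ∀ X {i} → i < n → rank X i < n
  rank< X {i} i<n = <-≤-trans
    (count-⊂ {Q = λ _ → ⊤} (λ k → X k <? X i) (λ _ → yes tt) n _ i<n tt (<-irrefl refl)) (count≤ _ n)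

  rank-incr : ∀ X {i j} → i < n → X i < X j → rank X i < rank X j
  rank-incr X i<n lt = count-⊂ _ _ n (λ _ h → <-trans h lt) i<n lt (<-irrefl refl)

  toWord : Seq → Word n
  toWord X = tabulate (λ i → fromℕ< (rank< X (toℕ<n i)))

  seq-toWord : ∀ X {i} → i < n → seq (toWord X) i ≡ rank X i
  seq-toWord X = onFin λ i → trans (seq-toℕ (toWord X) i)
    (trans (cong toℕ (lookup∘tabulate _ i)) (toℕ-fromℕ< _))

  toWord-same : ∀ X {l} → Same n X l (seq (toWord X)) l
  toWord-same X = same (λ i j lt → subst₂ _<_ (sym (seq-toWord X i)) (sym (seq-toWord X j)) (rank-incr X i lt)) (λ _ → refl)

  perm-inj : ∀ {π} → IsPerm π → Inj n (seq π)
  perm-inj {π} perm i<n j<n = onFin {λ i → ∀ {j} → j < n → seq π i ≡ seq π j → i ≡ j}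
    (λ i → onFin {λ j → seq π (toℕ i) ≡ seq π j → toℕ i ≡ j} λ j e →
      cong toℕ (perm (toℕ-injective (trans (sym (seq-toℕ π i)) (trans e (seq-toℕ π j)))))) i<n j<n

  inj-perm : ∀ {π} → Inj n (seq π) → IsPerm π
  inj-perm {π} inj {i} {j} e = toℕ-injective (inj (toℕ<n i) (toℕ<n j)
    (trans (seq-toℕ π i) (trans (cong toℕ e) (sym (seq-toℕ π j)))))

-- The two notions of pattern containment

pattern₄ : Bool → Word 4
pattern₄ true  = p1423
pattern₄ false = p2413

pattern #0 = Fin.zero
pattern #1 = Fin.suc Fin.zero
pattern #2 = Fin.suc (Fin.suc Fin.zero)
pattern #3 = Fin.suc (Fin.suc (Fin.suc Fin.zero))

incr₄ : ∀ {n} (v : Fin 4 → Fin n) → v #0 Fin.< v #1 → v #1 Fin.< v #2 → v #2 Fin.< v #3 →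
        ∀ x y → x Fin.< y → v x Fin.< v y
incr₄ v p q r #0 #1 _ = p
incr₄ v p q r #0 #2 _ = <-trans p q
incr₄ v p q r #0 #3 _ = <-trans p (<-trans q r)
incr₄ v p q r #1 #2 _ = q
incr₄ v p q r #1 #3 _ = <-trans q r
incr₄ v p q r #2 #3 _ = r
incr₄ v p q r _  #0 ()
incr₄ v p q r #1 #1 (s≤s ())
incr₄ v p q r #2 #1 (s≤s ())
incr₄ v p q r #3 #1 (s≤s ())
incr₄ v p q r #2 #2 (s≤s (s≤s ()))
incr₄ v p q r #3 #2 (s≤s (s≤s ()))
incr₄ v p q r #3 #3 (s≤s (s≤s (s≤s ())))

module _ {n : ℕ} where

  finAt : ∀ {i} → i < n → ∃ λ (x : Fin n) → toℕ x ≡ i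
  finAt i<n = fromℕ< i<n , toℕ-fromℕ< i<n

  contains : ∀ b (π : Word n) {i j k l} → i Fin.< j → j Fin.< k → k Fin.< l →
             Pat b (seq π (toℕ i)) (seq π (toℕ j)) (seq π (toℕ k)) (seq π (toℕ l)) → Contains (pattern₄ b) π
  contains b π {i} {j} {k} {l} i<j j<k k<l P =
    ι , incr₄ ι i<j j<k k<l , λ x y → subst₂ (λ r s → (lookup (pattern₄ b) x Fin.< lookup (pattern₄ b) y) ⇔ (r Fin.< s))
      (sym (ι-val b x)) (sym (ι-val b y))
      (mk⇔ (val-incr b P _ _) (reflect (λ e → cong (toℕ ∘ val b) (toℕ-injective e)) (val-incr b P _ _)))
    where
    ι : Fin 4 → Fin n
    ι = lookup (i ∷ j ∷ k ∷ l ∷ [])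
    -- the four values in increasing order
    val : Bool → Fin 4 → Fin n
    val true  = lookup π ∘ lookup (i ∷ k ∷ l ∷ j ∷ [])
    val false = lookup π ∘ lookup (k ∷ i ∷ l ∷ j ∷ [])
    ι-val : ∀ b x → lookup π (ι x) ≡ val b (lookup (pattern₄ b) x)
    ι-val true  #0 = refl
    ι-val true  #1 = refl
    ι-val true  #2 = refl
    ι-val true  #3 = refl
    ι-val false #0 = refl
    ι-val false #1 = refl
    ι-val false #2 = refl
    ι-val false #3 = refl
    val-incr : ∀ b → Pat b (seq π (toℕ i)) (seq π (toℕ j)) (seq π (toℕ k)) (seq π (toℕ l)) →
               ∀ x y → x Fin.< y → val b x Fin.< val b y
    val-incr true  (u , v , w) = incr₄ (val true)  (seq-<⁻ π i k u) (seq-<⁻ π k l v) (seq-<⁻ π l j w)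
    val-incr false (u , v , w) = incr₄ (val false) (seq-<⁻ π k i u) (seq-<⁻ π i l v) (seq-<⁻ π l j w)

  contains⁻ : ∀ b (π : Word n) → Contains (pattern₄ b) π → ¬ Av b n (seq π)
  contains⁻ b π (ι , ι-incr , vals) av =
    av (ι-incr #0 #1 (s≤s z≤n)) (ι-incr #1 #2 (s≤s (s≤s z≤n))) (ι-incr #2 #3 (s≤s (s≤s (s≤s z≤n)))) (toℕ<n (ι #3)) (go b vals)
    where
    go : ∀ b → (∀ x y → (lookup (pattern₄ b) x Fin.< lookup (pattern₄ b) y) ⇔ (lookup π (ι x) Fin.< lookup π (ι y))) →
         Pat b (seq π (toℕ (ι #0))) (seq π (toℕ (ι #1))) (seq π (toℕ (ι #2))) (seq π (toℕ (ι #3)))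
    go true  vals = lt #0 #2 (s≤s z≤n) , lt #2 #3 (s≤s (s≤s z≤n)) , lt #3 #1 (s≤s (s≤s (s≤s z≤n)))
      where
      lt : ∀ x y → lookup p1423 x Fin.< lookup p1423 y → seq π (toℕ (ι x)) < seq π (toℕ (ι y))
      lt x y h = seq-< π (ι x) (ι y) (Equivalence.to (vals x y) h)
    go false vals = lt #2 #0 (s≤s z≤n) , lt #0 #3 (s≤s (s≤s z≤n)) , lt #3 #1 (s≤s (s≤s (s≤s z≤n)))
      where
      lt : ∀ x y → lookup p2413 x Fin.< lookup p2413 y → seq π (toℕ (ι x)) < seq π (toℕ (ι y))
      lt x y h = seq-< π (ι x) (ι y) (Equivalence.to (vals x y) h)

  avoids-av : ∀ b (π : Word n) → Avoids (pattern₄ b) π → Av b n (seq π)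
  avoids-av b π av i<j j<k k<l l<n P
    with finAt (<-trans i<j (<-trans j<k (<-trans k<l l<n))) | finAt (<-trans j<k (<-trans k<l l<n)) | finAt (<-trans k<l l<n) | finAt l<n
  ... | i , refl | j , refl | k , refl | l , refl = av (contains b π i<j j<k k<l P)

valid-of : ∀ {b n X} → Inj n X → Av b n X → Valid b 0 n X (const 0)
valid-of {b} {n} {X} inj av = record
  { inj = inj ; av = av ; bnd = λ _ → z≤n ; occ = λ () ; anti = λ _ _ _ → z≤n ; lv = lv b }
  where
  lv : ∀ b → LvCond b 0 n X (const 0)
  lv true  _ _ ()
  lv false _ _ = z≤n

valid-same : ∀ {b n X l Y} → Same n X l Y (const 0) → Valid b 0 n X l → Valid b 0 n Y (const 0)
valid-same {b} {n} {X} {l} {Y} s V = valid-of injY λ i<j j<k k<l l<n P →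
  let k<n = <-trans k<l l<n
      j<n = <-trans j<k k<n
      i<n = <-trans i<j j<n
  in V.av i<j j<k k<l l<n (Pat-map b (⟸ i<n k<n) (⟸ k<n i<n) (⟸ i<n l<n) (⟸ k<n l<n) (⟸ l<n j<n) P)
  where
  module V = Valid V
  ⟸ : ∀ {i j} → i < n → j < n → Y i < Y j → X i < X j
  ⟸ = ord⁻ V.inj s
  injY : Inj n Y
  injY {i} {j} i<n j<n e with <-cmp (X i) (X j)
  ... | tri< t _ _ = <⇒≢′ (Same.ord s i<n j<n t) e
  ... | tri≈ _ t _ = V.inj i<n j<n t
  ... | tri> _ _ t = <⇒≢′ (Same.ord s j<n i<n t) (sym e)

-- Code b π t: the tree t describes π as a permutation avoiding pattern₄ b.
Code : ∀ {n} → Bool → Word n → Tree → Set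
Code {n} b π t = Enc b t 0 n (seq π) (const 0)

code : ∀ {n} b (π : Word n) → InAv (pattern₄ b) π → ∃ (Code b π)
code b π (perm , av) = parse (valid-of (perm-inj perm) (avoids-av b π av))

code-avoids : ∀ {n b t} {π : Word n} → Code b π t → InAv (pattern₄ b) π
code-avoids {b = b} {π = π} c = inj-perm (Valid.inj (valid c)) , λ h → contains⁻ b π h (Valid.av (valid c))

code-unique : ∀ {n b b′ t t′} {π : Word n} → Code b π t → Code b′ π t′ → t ≡ t′
code-unique c c′ = uniq c c′ (same (λ _ _ lt → lt) (λ _ → refl))

-- The rebuilt sequence has arbitrary values and is standardized. The result is parsed afresh, and
-- `uniq` identifies its tree with the given one.
transport : ∀ {n b t} {π : Word n} b′ → Code b π t → ∃ λ σ → Code {n} b′ σ t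
transport b′ c with build b′ c
... | Y , l , e with relevel {l′ = const 0} (λ i → n≤0⇒n≡0 (Valid.bnd (valid e) i)) e
...   | e′ with parse (valid-same (toWord-same Y) (valid e′))
...     | t′ , c′ with refl ← uniq e′ c′ (toWord-same Y) = toWord Y , c′

surjective : ∀ {n} (π : Word n) → IsPerm π → ∀ v → ∃ λ i → lookup π i ≡ v
surjective {zero} π perm ()
surjective {suc n} π perm v with any? (λ i → lookup π i Fin.≟ v)
... | yes r = r
... | no ne = ⊥-elim (<-irrefl refl (injective⇒≤ {f = λ i → Fin.punchOut (v≢ i)} λ {i} {j} e →
                perm (punchOut-injective (v≢ i) (v≢ j) e)))
  where
  v≢ : ∀ i → v ≢ lookup π i
  v≢ i e = ne (i , sym e)

module _ {n : ℕ} where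

  -- Below a letter of value `v` in π there are `v` further letters in a descending chain of values,
  -- and the chain stays strict in σ.
  values≤ : (π σ : Word n) → IsPerm π → (∀ {i j} → lookup π i Fin.< lookup π j → lookup σ i Fin.< lookup σ j) →
            ∀ v {i} → toℕ (lookup π i) ≡ v → v ≤ toℕ (lookup σ i)
  values≤ π σ perm ord zero    _ = z≤n
  values≤ π σ perm ord (suc v) {i} e with finAt (<-trans (≤-reflexive (sym e)) (toℕ<n (lookup π i)))
  ... | u , u≡ with surjective π perm u
  ...   | j , j≡ = ≤-<-trans (values≤ π σ perm ord v {j} πj) (ord (≤-reflexive (trans (cong suc πj) (sym e))))
    where
    πj : toℕ (lookup π j) ≡ v
    πj = trans (cong toℕ j≡) u≡

  word-unique : {π σ : Word n} → IsPerm π → IsPerm σ → Same n (seq π) (const 0) (seq σ) (const 0) → π ≡ σ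
  word-unique {π} {σ} perm perm′ s = trans (sym (tabulate∘lookup π)) (trans (tabulate-cong eq) (tabulate∘lookup σ))
    where
    eq : ∀ i → lookup π i ≡ lookup σ i
    eq i = toℕ-injective (≤-antisym
      (values≤ π σ perm (λ {i} {j} lt → seq-<⁻ σ i j (Same.ord s (toℕ<n i) (toℕ<n j) (seq-< π i j lt))) _ refl)
      (values≤ σ π perm′ (λ {i} {j} lt → seq-<⁻ π i j (ord⁻ (perm-inj perm) s (toℕ<n i) (toℕ<n j) (seq-< σ i j lt))) _ refl))

code-injective : ∀ {n b t} {π σ : Word n} → Code b π t → Code b σ t → π ≡ σ
code-injective c c′ = word-unique (proj₁ (code-avoids c)) (proj₁ (code-avoids c′)) (det c c′)

-- The map Θ on all words

inAv? : ∀ {n} (π : Word n) → Dec (InAv p1423 π)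
inAv? {n} π = map′ from to (allInj? ×-dec ¬? occurrence?)
  where
  X = seq π
  AllInj Occurrence : Set
  AllInj = ∀ {i} → i < n → ∀ {j} → j < n → X i ≡ X j → i ≡ j
  Occurrence = ∃ λ l → l < n × ∃ λ k → k < l × ∃ λ j → j < k × ∃ λ i → i < j × Pat true (X i) (X j) (X k) (X l)
  allInj? : Dec AllInj
  allInj? = allUpTo? (λ i → allUpTo? (λ j → (X i ≟ X j) →-dec (i ≟ j)) n) n
  occurrence? : Dec Occurrence
  occurrence? = anyUpTo? (λ l → anyUpTo? (λ k → anyUpTo? (λ j → anyUpTo? (λ i →
    (X i <? X k) ×-dec ((X k <? X l) ×-dec (X l <? X j))) j) k) l) n
  from : AllInj × ¬ Occurrence → InAv p1423 π
  from (inj , ne) = inj-perm {π = π} (λ i j → inj i j) ,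
    λ h → contains⁻ true π h λ i<j j<k k<l l<n P → ne (_ , l<n , _ , k<l , _ , j<k , _ , i<j , P)
  to : InAv p1423 π → AllInj × ¬ Occurrence
  to (perm , av) = (λ i {_} j → perm-inj perm i j) ,
    λ (_ , l<n , _ , k<l , _ , j<k , _ , i<j , P) → avoids-av true π av i<j j<k k<l l<n P

-- Θ has to be total, so membership is decided first and words outside the class are left unchanged.
image : ∀ {n} (π : Word n) → Dec (InAv p1423 π) → Word n
image π (yes h) = proj₁ (transport false (proj₂ (code true π h)))
image π (no _)  = π

theta : ∀ {n} → Word n → Word n
theta π = image π (inAv? π)

-- The tree found inside `image` need not be `t` by definition; `code-unique` equates the two.
theta-code : ∀ {n t} {π : Word n} → Code true π t → Code false (theta π) t
theta-code {n} {t} {π} c = go (inAv? π)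
  where
  go : (d : Dec (InAv p1423 π)) → Code false (image π d) t
  go (no ¬h) = ⊥-elim (¬h (code-avoids {π = π} c))
  go (yes h) = subst (Code false (image π (yes h))) (sym (code-unique c (proj₂ (code true π h))))
                 (proj₂ (transport false (proj₂ (code true π h))))

-- Second largest value and statistics of words

secondPos : Tree → ℕ
secondPos nil                              = 0
secondPos (first _ _ _ t)                  = suc (maxPos t)
secondPos (node a _ _ _ true  _ _  tF)     = a + suc (maxPos tF)
secondPos (node a _ _ _ false _ tA _)      = maxPos tA

record Second (n : ℕ) (X : Seq) (a s : ℕ) : Set where
  field
    s<n  : s < n
    s≢a  : s ≢ a
    next : ∀ {k} → k < n → k ≢ a → k ≢ s → X k < X s

-- Without thresholds, `f₁` tells whether a letter of ρ exceeds all of α. If so, the largest letter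
-- of ρ is second; otherwise it is the largest letter of α, which is that of A because all marks lie
-- below the top gap.
second : ∀ {b t n X l} → Enc b t 0 n X l → 1 < n → Second n X (maxPos t) (secondPos t)
second nil ()
second {X = X} (first {m = m} refl _ _ _ _ eF) 1<n = record { s<n = s<s (maxPos< eF (s<s⁻¹ 1<n)) ; s≢a = λ () ; next = next }
  where
  next : ∀ {k} → k < suc m → k ≢ 0 → k ≢ suc _ → X k < X (suc _)
  next {zero}  _ ne _  = ⊥-elim (ne refl)
  next {suc k} h _  ne = maxPos-max eF (s<s⁻¹ h) (λ e → ne (cong suc e))
second {b} {X = X} {l} e@(node {a} {m} {p} {N} {f₁} {f₂} {tA} {tF} {A = A} {F = F} {g = g} refl nd lvs eA eF) _ = go f₁ refl
  where
  module NX = NodeFacts nd lvs (valid eA) (valid eF)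
  module DX = Node nd
  l≡0 : ∀ {j} → j < m → l (a + suc j) ≡ 0
  l≡0 j<m = n≤0⇒n≡0 (Levels.l≤ lvs j<m)
  go : ∀ f → f₁ ≡ f → Second (a + suc m) X a (secondPos (node a m p N f f₂ tA tF))
  go true  f≡ = record { s<n = right<end M<m ; s≢a = >⇒≢ (m<m+n a z<s) ; next = λ k → next (pos a m k) }
    where
    M = maxPos tF
    0<m : 0 < m
    0<m = let (_ , j<m , _) = Valid.occ (valid eF) (NX.f₁-occupied f≡) in ≤-<-trans z≤n j<m
    M<m : M < m
    M<m = maxPos< eF 0<m
    F≤ : ∀ {k} → k < m → F k ≤ F M
    F≤ {k} k<m with k ≟ M
    ... | yes e = ≤-reflexive (cong F e)
    ... | no ne = <⇒≤ (maxPos-max eF k<m ne)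
    g0 : g M ≡ 0
    g0 = proj₁ (NX.zero-level M<m f≡ (NX.max-level (NX.f₁-occupied f≡) M<m F≤))
    next : ∀ {k} → Pos a m k → k ≢ a → k ≢ a + suc M → X k < X (a + suc M)
    next (left u)  _  _  = DX.above u M<m g0
    next peak      ne _  = ⊥-elim (ne refl)
    next (right u) _  ne = DX.inρ u M<m (maxPos-max eF u (λ e → ne (cong (λ j → a + suc j) e)))
  go false f≡ = record { s<n = left<end M<a ; s≢a = <⇒≢ M<a ; next = λ k → next (pos a m k) }
    where
    M = maxPos tA
    M<a : M < a
    M<a = inside (pos₂ a p (maxPos< eA (<-≤-trans NX.a>0 (m≤m+n a p)))) refl
      where
      inside : ∀ {x} → Pos₂ a p x → x ≡ M → x < a
      inside (left u)      _ = u
      inside (right {k} u) e =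
        let (i , i<a , r) = Cond.high DX.cond
            i<ak = <-≤-trans i<a (m≤m+n a k)
        in asym (r i<ak (+-monoʳ-< a u))
                (subst (λ x → A i < A x) (sym e) (maxPos-max eA (left<end i<a) (λ i≡ → <⇒≢′ i<ak (trans i≡ (sym e)))))
    ≤M : ∀ {k} → k < a → X k ≤ X M
    ≤M {k} u with k ≟ M
    ... | yes e = ≤-reflexive (cong X e)
    ... | no ne = <⇒≤ (DX.inα u M<a (maxPos-max eA (left<end u) ne))
    next : ∀ {k} → Pos a m k → k ≢ a → k ≢ M → X k < X M
    next (left u)  _  ne = DX.inα u M<a (maxPos-max eA (left<end u) ne)
    next peak      ne _  = ⊥-elim (ne refl)
    next (right {j} u) _ _ = 0<-or (g j)
      (λ e → ⊥-elim (not-¬ (NX.first-top u e (l≡0 u)) f≡))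
      (λ o → let (i , i<a , lt) = NX.below-some u o in <-≤-trans lt (≤M i<a))

module Statistics {m} {π : Word (suc m)} {b t} (c : Code b π t) where

  private
    n = suc m
    X = seq π
    perm = proj₁ (code-avoids c)

  value< : ∀ {k} → k < n → X k < n
  value< = onFin {P = λ k → X k < n} λ i → subst (_< n) (sym (seq-toℕ π i)) (toℕ<n (lookup π i))

  hit : ∀ {v} → v < n → ∃ λ i → X (toℕ i) ≡ v
  hit v<n with finAt v<n
  ... | u , u≡ with surjective π perm u
  ...   | i , e = i , trans (seq-toℕ π i) (trans (cong toℕ e) u≡)

  max-unique : ∀ {k} → k < n → X k ≡ m → k ≡ maxPos t
  max-unique {k} k<n e with k ≟ maxPos t
  ... | yes k≡ = k≡
  ... | no ne  = ⊥-elim (<-irrefl refl (<-≤-trans (maxPos-max c k<n ne)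
                   (≤-trans (s≤s⁻¹ (value< (maxPos< c z<s))) (≤-reflexive (sym e)))))

  holdsMax : ∀ i → HoldsMax π i ⇔ toℕ i ≡ maxPos t
  holdsMax i = mk⇔ (λ e → max-unique (toℕ<n i) (trans (seq-toℕ π i) e)) from
    where
    from : toℕ i ≡ maxPos t → HoldsMax π i
    from e with hit (n<1+n m)
    ... | k , k≡ with refl ← toℕ-injective (trans e (sym (max-unique (toℕ<n k) k≡))) = trans (sym (seq-toℕ π k)) k≡

  max≤ : X (maxPos t) ≤ m
  max≤ = s≤s⁻¹ (value< (maxPos< c z<s))

  max-value : X (maxPos t) ≡ m
  max-value with hit (n<1+n m)
  ... | k , k≡ = trans (cong X (sym (max-unique (toℕ<n k) k≡))) k≡

  second-unique : 1 < n → ∀ {k} → k < n → suc (X k) ≡ m → k ≡ secondPos t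
  second-unique 1<n {k} k<n e with k ≟ secondPos t
  ... | yes k≡ = k≡
  ... | no ne  = ⊥-elim (<-irrefl refl (<-≤-trans (≤-<-trans (≤-trans (≤-reflexive (sym e)) (S.next k<n k≢max ne))
                   (maxPos-max c S.s<n S.s≢a)) max≤))
    where
    module S = Second (second c 1<n)
    k≢max : k ≢ maxPos t
    k≢max k≡ = <⇒≢′ (n<1+n m) (sym (trans (cong suc (sym (trans (cong X k≡) max-value))) e))

  -- For `n = 1` no position holds the value in question, whence the conjunct `1 < n`.
  holdsSecond : ∀ i → HoldsSecond π i ⇔ (1 < n × toℕ i ≡ secondPos t)
  holdsSecond i = mk⇔ to from
    where
    to : HoldsSecond π i → 1 < n × toℕ i ≡ secondPos t
    to e = 1<n , second-unique 1<n (toℕ<n i) (trans (cong suc (seq-toℕ π i)) e)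
      where
      1<n : 1 < n
      1<n = s<s (subst (0 <_) e z<s)
    from : 1 < n × toℕ i ≡ secondPos t → HoldsSecond π i
    from (1<n , e) with hit {m ∸ 1} (s≤s (m∸n≤m m 1))
    ... | k , k≡ with refl ← toℕ-injective (trans e (sym (second-unique 1<n (toℕ<n k) (trans (cong suc k≡) (m+[n∸m]≡n (s≤s⁻¹ 1<n)))))) =
      trans (cong suc (trans (sym (seq-toℕ π k)) k≡)) (m+[n∸m]≡n (s≤s⁻¹ 1<n))

  rlmax : ∀ i → IsRLmax π i ⇔ RL n X (toℕ i)
  rlmax i = mk⇔ to (λ r j i<j → seq-<⁻ π j i (r i<j (toℕ<n j)))
    where
    to : IsRLmax π i → RL n X (toℕ i)
    to r i<k k<n with finAt k<n
    ... | k , refl = seq-< π k i (r k i<k)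

  stp-seq : ∀ {i j} → toℕ (lookup π i) ≡ suc (toℕ (lookup π j)) → Stp n X (const 0) (toℕ i) (toℕ j)
  stp-seq {i} {j} e = stp (≤-reflexive (sym e′)) refl
    λ _ u v → <-irrefl refl (<-≤-trans v (≤-trans (≤-reflexive e′) u))
    where
    e′ : X (toℕ i) ≡ suc (X (toℕ j))
    e′ = trans (seq-toℕ π i) (trans e (cong suc (sym (seq-toℕ π j))))

  -- In a permutation every value in between is taken, so a gap larger than one would contain a
  -- letter.
  seq-stp : ∀ {i j} → Stp n X (const 0) (toℕ i) (toℕ j) → toℕ (lookup π i) ≡ suc (toℕ (lookup π j))
  seq-stp {i} {j} (stp des _ none) with m≤n⇒m<n∨m≡n des
  ... | inj₂ e = trans (sym (seq-toℕ π i)) (trans (sym e) (cong suc (seq-toℕ π j)))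
  ... | inj₁ lt with hit (<-trans lt (value< (toℕ<n i)))
  ...   | k , k≡ = ⊥-elim (none (toℕ<n k) (≤-reflexive (sym k≡)) (subst (_< X (toℕ i)) (sym k≡) lt))

module _ {m} {π σ : Word (suc m)} {b b′ t} (c : Code b π t) (c′ : Code b′ σ t) where

  private
    module P = Statistics c
    module S = Statistics c′
    module I = Imp (imp c c′)

  des-⇒ : ∀ i → IsDes π i → IsDes σ i
  des-⇒ i (j , e , lt) = j , e , seq-<⁻ σ j i (I.des (sym e) (toℕ<n j) (seq-< π j i lt))

  rl-⇒ : ∀ i → IsRLmax π i → IsRLmax σ i
  rl-⇒ i r = Equivalence.from (S.rlmax i) (λ i<k k<n → I.rl (toℕ<n i) (λ i<k k<n → Equivalence.to (P.rlmax i) r i<k k<n) i<k k<n)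

  stp-⇒ : ∀ i → IsStp π i → IsStp σ i
  stp-⇒ i (j , e , st) = j , e , S.seq-stp (I.step (sym e) (toℕ<n j) (P.stp-seq st))

  max-⇒ : ∀ i → HoldsMax π i → HoldsMax σ i
  max-⇒ i = Equivalence.from (S.holdsMax i) ∘ Equivalence.to (P.holdsMax i)

  second-⇒ : ∀ i → HoldsSecond π i → HoldsSecond σ i
  second-⇒ i = Equivalence.from (S.holdsSecond i) ∘ Equivalence.to (P.holdsSecond i)

mainTheorem1 : (m : ℕ) →
    Σ (Word (suc m) → Word (suc m)) λ Θ →
    (∀ π → InAv p1423 π → InAv p2413 (Θ π)) ×
    (∀ π π′ → InAv p1423 π → InAv p1423 π′ → Θ π ≡ Θ π′ → π ≡ π′) ×
    (∀ σ → InAv p2413 σ → Σ (Word (suc m)) λ π → InAv p1423 π × Θ π ≡ σ) ×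
    (∀ π → InAv p1423 π →
    (∀ (i : Fin (suc m)) → IsDes (Θ π) i ⇔ IsDes π i) ×
    (∀ (i : Fin (suc m)) → IsRLmax (Θ π) i ⇔ IsRLmax π i) ×
    (∀ (i : Fin (suc m)) → IsStp (Θ π) i ⇔ IsStp π i) ×
    (∀ (i : Fin (suc m)) → HoldsMax (Θ π) i ⇔ HoldsMax π i) ×
    (∀ (i : Fin (suc m)) → HoldsSecond (Θ π) i ⇔ HoldsSecond π i)) ×
    (∀ π → InAv p1423 π → InAv p2413 π → Θ π ≡ π)
mainTheorem1 m = theta , maps , injective , onto , statistics , fixes
  where
  maps : ∀ π → InAv p1423 π → InAv p2413 (theta π)
  maps π h = code-avoids (theta-code (proj₂ (code true π h)))
  injective : ∀ π π′ → InAv p1423 π → InAv p1423 π′ → theta π ≡ theta π′ → π ≡ π′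
  injective π π′ h h′ e = go (code true π h) (code true π′ h′)
    where
    go : ∃ (Code true π) → ∃ (Code true π′) → π ≡ π′
    go (t , c) (t′ , c′) = code-injective c (subst (Code true π′)
      (sym (code-unique (subst (λ σ → Code false σ t) e (theta-code c)) (theta-code c′))) c′)
  onto : ∀ σ → InAv p2413 σ → Σ (Word (suc m)) λ π → InAv p1423 π × theta π ≡ σ
  onto σ h = go (code false σ h)
    where
    go : ∃ (Code false σ) → Σ (Word (suc m)) λ π → InAv p1423 π × theta π ≡ σ
    go (t , c) = let (π , c′) = transport true c in π , code-avoids c′ , code-injective (theta-code c′) c
  statistics : ∀ π → InAv p1423 π →
    (∀ i → IsDes (theta π) i ⇔ IsDes π i) × (∀ i → IsRLmax (theta π) i ⇔ IsRLmax π i) ×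
    (∀ i → IsStp (theta π) i ⇔ IsStp π i) × (∀ i → HoldsMax (theta π) i ⇔ HoldsMax π i) ×
    (∀ i → HoldsSecond (theta π) i ⇔ HoldsSecond π i)
  statistics π h = go (proj₂ (code true π h)) (theta-code (proj₂ (code true π h)))
    where
    go : ∀ {σ t} → Code true π t → Code false σ t →
      (∀ i → IsDes σ i ⇔ IsDes π i) × (∀ i → IsRLmax σ i ⇔ IsRLmax π i) ×
      (∀ i → IsStp σ i ⇔ IsStp π i) × (∀ i → HoldsMax σ i ⇔ HoldsMax π i) ×
      (∀ i → HoldsSecond σ i ⇔ HoldsSecond π i)
    go c c′ = (λ i → mk⇔ (des-⇒ c′ c i) (des-⇒ c c′ i)) , (λ i → mk⇔ (rl-⇒ c′ c i) (rl-⇒ c c′ i)) ,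
              (λ i → mk⇔ (stp-⇒ c′ c i) (stp-⇒ c c′ i)) , (λ i → mk⇔ (max-⇒ c′ c i) (max-⇒ c c′ i)) ,
              (λ i → mk⇔ (second-⇒ c′ c i) (second-⇒ c c′ i))
  -- By uniqueness across kinds both readings of π have the same tree, so `theta π` and π are 2413
  -- readings of one tree.
  fixes : ∀ π → InAv p1423 π → InAv p2413 π → theta π ≡ π
  fixes π h h′ = go (code true π h) (code false π h′)
    where
    go : ∃ (Code true π) → ∃ (Code false π) → theta π ≡ π
    go (t , c) (t′ , c′) = code-injective (theta-code c) (subst (Code false π) (sym (code-unique c c′)) c′)
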